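{- Let $n\ge1$ and let $\mathcal{T}$ be an $n$-periodic triangulation of the strip $\mathcal{U}_n$ with $1\le r\le n$ bridging arcs, up to translates. Let $\mathcal{F}_n=(m_{ij})_{j-i\ge -2}$ be the $n$-arithmetic frieze associated to $\mathcal{T}$ with common differences $d_{ik}=m_{i,(i+k-3)+n}-m_{i,i+k-3}$ ($i\in\mathbb{Z}$, $k\in\{1,\dots,n\}$). Then $$d_{ik}=r\, n_{i-1}\, n_{i+k-2},$$ where $i-1$ and $i+k-2$ are reduced modulo $n$ (to representatives in $\{1,\dots,n\}$), and $(n_1,\dots,n_n)$ are the labels of the lower vertices of $\mathcal{U}_n$ obtained from $\mathcal{T}$ by the labeling algorithm with a starting vertex on the upper boundary.
   Context: Infinite friezes: an infinite frieze is an array $(m_{ij})_{i,j\in\mathbb{Z},\,j-i\ge -2}$ of integers with $m_{i,i-2}=0$, $m_{i,i-1}=1$ for all $i$, $m_{ij}>0$ for all $j\ge i$, and $m_{ij}m_{i+1,j+1}-m_{i+1,j}m_{i,j+1}=1$ for all $j-i\ge -1$. It is $n$-periodic if $m_{ij}=m_{i+n,j+n}$ for all $i\le j$; its quiddity sequence is then $(m_{11},\dots,m_{nn})$, which determines it. It is $n$-arithmetic if, with $d_{ik}=m_{i,(i+k-3)+n}-m_{i,i+k-3}$, one has $m_{i,(i+k-3)+(l+1)n}-m_{i,(i+k-3)+ln}=d_{ik}$ for all $l\ge0$, $i\in\mathbb{Z}$, $k\in\{1,\dots,n\}$; the $d_{ik}$ are the common differences. Strip: $\mathcal{U}_n$ is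 $\mathbb{R}\times$ (closed interval) with vertices $0^{(k)}$, $k\in\mathbb{Z}$, on the upper boundary and vertices $1^{(k)},\dots,n^{(k)}$, $k\in\mathbb{Z}$, on the lower boundary, ordered from left to right on the lower boundary by: $i^{(k)}\le j^{(l)}$ iff $k<l$, or $k=l$ and $i\le j$; the vertices $0^{(k)}$ are ordered from left to right by $k$, with $0^{(k)}$ above $1^{(k)},\dots,n^{(k)}$. An arc in $\mathcal{U}_n$ is (the isotopy class of) a non-self-intersecting curve connecting two vertices such that (A1) at least one vertex is on the lower boundary; (A2) the two vertices are neither equal nor neighbors; (A3) if one vertex is on the upper boundary, the superscripts of the two vertices are equal. Arcs $0^{(k)}j^{(k)}$ to the upper boundary are called bridging. A triangulation of $\mathcal{U}_n$ is a maximal collection of arcs that pairwise do not meet in the interior of $\mathcal{U}_n$; the regions into which it cuts $\mathcal{U}_n$ are called triangles. It is $n$-periodic if it has a fundamental domain: an $(n+3)$-gon $\mathcal{P}$ with vertices $0^{(k)},0^{(k+1)}$ and $i^{(k)},(i+1)^{(k)},\dots,n^{(k)},1^{(k+1)},\dots,i^{(k+1)}$ for some $i\in\{1,\dots,n\}$, $k\in\mathbb{Z}$, bounded on the sides by the arcs $0^{(k)}i^{(k)}$ and $0^{(k+1)}i^{(k+1)}$ of the triangulation, such that the triangulation is covered by the horizontal translates of $\mathcal{P}$ (shifting superscripts by integers); translates are taken with respect to these shifts, so $r$ is the number of $j\in\{1,\dots,n\}$ with $0^{(k)}j^{(k)}\in\mathcal{T}$ (for any fixed $k$). In an $n$-periodic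 triangulation each triangle is either bounded by three sides, or is a four-sided region with vertices $i^{(k)},i'^{(k+1)},0^{(k)},0^{(k+1)}$ having one side on the upper boundary (such a region also counts as a triangle). Associated frieze: the quiddity sequence of an $n$-periodic triangulation $\mathcal{T}$ is $(a_1,\dots,a_n)$, where $a_i$ is the number of triangles of $\mathcal{T}$ incident with $i^{(k)}$ (independent of $k$). The frieze associated to $\mathcal{T}$ is the $n$-periodic infinite frieze with $m_{ii}=a_i$ for $1\le i\le n$ (it exists and is $n$-arithmetic). Labels with starting vertex $v=0^{(k)}$ on the upper boundary: all vertices on the upper boundary always share one common label, so $n_v(w)=0$ for every upper vertex $w$. Set $n_v(w)=1$ for every lower vertex $w$ joined with $v$ by an arc of $\mathcal{T}$. All remaining lower vertices are labeled iteratively: in any triangle of $\mathcal{T}$, in which upper vertices $0^{(k')},0^{(k'+1)}$ (if both occur) are regarded as one single vertex, whenever two of the three vertices are labeled, the remaining vertex gets as label the sum of the two given labels. The label of $i^{(k')}$ then depends neither on $k'$ nor on $k$, and is denoted $n_i$, for $1\le i\le n$. -}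

module Defs where

open import Data.Fin.Base as Fin using (Fin; toℕ; fromℕ<)
open import Data.Integer.Base as ℤ using (ℤ; +_)
open import Data.Integer.DivMod using (_%ℕ_; n%ℕd<d)
open import Data.List.Base using (List; []; _∷_; length)
open import Data.List.Membership.Propositional using (_∈_)
open import Data.List.Relation.Unary.Unique.Propositional using (Unique)
open import Data.Nat.Base as ℕ using (ℕ; zero; suc; NonZero)
open import Data.Product.Base using (Σ-syntax; ∃-syntax; _×_)
open import Data.Sum.Base using (_⊎_)
open import Function.Bundles using (_⇔_)
open import Level using (0ℓ)
open import Relation.Binary.Core using (Rel; _⇒_)
open import Relation.Binary.Definitions using (Decidable; Symmetric)
open import Relation.Binary.PropositionalEquality.Core using (_≡_; _≢_)
open import Relation.Nullary.Negation.Core using (¬_)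

HasCardinality : {A : Set} → (A → Set) → ℕ → Set
HasCardinality {A} Q c =
  Σ[ xs ∈ List A ] (Unique xs × (∀ x → x ∈ xs ⇔ Q x) × length xs ≡ c)

------------------------------------------------------------------------
-- The strip

-- `upper k` is 0^(k).  Since `Fin n` is 0-based, `lower i k` is the
-- vertex (toℕ i + 1)^(k).
data Vertex (n : ℕ) : Set where
  upper : (k : ℤ) → Vertex n
  lower : (i : Fin n) (k : ℤ) → Vertex n

module _ {n : ℕ} where

  data IsUpper : Vertex n → Set where
    upper : ∀ k → IsUpper (upper k)

  data IsLower : Vertex n → Set where
    lower : ∀ i k → IsLower (lower i k)

  superscript : Vertex n → ℤ
  superscript (upper k)   = k
  superscript (lower i k) = k

  shift : ℤ → Vertex n → Vertex n
  shift s (upper k)   = upper (k ℤ.+ s)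
  shift s (lower i k) = lower i (k ℤ.+ s)

  -- The order in which the vertices are met when running once around the
  -- boundary of the strip, viewed as a disc: along the lower boundary from
  -- left to right, then back along the upper boundary from right to left.
  data _<∂_ : Rel (Vertex n) 0ℓ where
    lower-block : ∀ {i j k l} → k ℤ.< l → lower i k <∂ lower j l
    lower-index : ∀ {i j k} → i Fin.< j → lower i k <∂ lower j k
    lower-upper : ∀ {i k l} → lower i k <∂ upper l
    upper-upper : ∀ {k l} → l ℤ.< k → upper k <∂ upper l

  data _⋖_ : Rel (Vertex n) 0ℓ where
    upper-next : ∀ {k} → upper k ⋖ upper (k ℤ.+ + 1)
    lower-next : ∀ {i j k} → toℕ j ≡ suc (toℕ i) → lower i k ⋖ lower j k
    lower-wrap : ∀ {i j k} → suc (toℕ i) ≡ n → toℕ j ≡ 0 →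
                 lower i k ⋖ lower j (k ℤ.+ + 1)

  Neighbours : Rel (Vertex n) 0ℓ
  Neighbours u v = u ⋖ v ⊎ v ⋖ u

------------------------------------------------------------------------
-- Arcs and triangulations

  -- The strip is simply connected, so the isotopy class of an arc is
  -- determined by its (unordered) pair of endpoints.
  record IsArc (u v : Vertex n) : Set where
    field
      A1 : IsLower u ⊎ IsLower v
      A2 : u ≢ v × ¬ Neighbours u v
      A3 : IsUpper u ⊎ IsUpper v → superscript u ≡ superscript v

  -- The arcs {u , v} and {x , y} meet in the interior (for every choice of
  -- representing curves) exactly when their endpoints alternate along the
  -- boundary.  This is the case u < x < v < y; as collections of arcs are
  -- symmetric relations, it suffices to exclude this case.
  Alternate : (u v x y : Vertex n) → Set
  Alternate u v x y = u <∂ x × x <∂ v × v <∂ y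

-- A set of arcs, as a symmetric relation on endpoints.  Decidability
-- expresses that it is a set in the classical sense.
record ArcCollection (n : ℕ) : Set₁ where
  field
    Joined : Rel (Vertex n) 0ℓ
    joined? : Decidable Joined
    joined-sym : Symmetric Joined
    joined-arc : ∀ {u v} → Joined u v → IsArc u v

open ArcCollection public

module _ {n : ℕ} where

  NonCrossing : ArcCollection n → Set
  NonCrossing T =
    ∀ {u v x y} → Joined T u v → Joined T x y → ¬ Alternate u v x y

  record IsTriangulation (T : ArcCollection n) : Set₁ where
    field
      nonCrossing : NonCrossing T
      maximal     : ∀ (T′ : ArcCollection n) → NonCrossing T′ →
                    Joined T ⇒ Joined T′ → Joined T′ ⇒ Joined T

  -- The vertices of the (n+3)-gon bounded on the sides by the bridging arcs
  -- at `lower i k` and `lower i (k + 1)`.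
  data InPolygon (i : Fin n) (k : ℤ) : Vertex n → Set where
    upper-left  : InPolygon i k (upper k)
    upper-right : InPolygon i k (upper (k ℤ.+ + 1))
    lower-left  : ∀ {j} → i Fin.≤ j → InPolygon i k (lower j k)
    lower-right : ∀ {j} → j Fin.≤ i → InPolygon i k (lower j (k ℤ.+ + 1))

  record IsFundamentalDomain
           (T : ArcCollection n) (i : Fin n) (k : ℤ) : Set where
    field
      left-side  : Joined T (upper k) (lower i k)
      right-side : Joined T (upper (k ℤ.+ + 1)) (lower i (k ℤ.+ + 1))
      -- The arcs of T are exactly the translates of the arcs of T in the
      -- polygon.
      covered    : ∀ u v → Joined T u v ⇔
                   (∃[ s ] ∃[ u₀ ] ∃[ v₀ ]
                     InPolygon i k u₀ × InPolygon i k v₀ × Joined T u₀ v₀ ×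
                     u ≡ shift s u₀ × v ≡ shift s v₀)

  IsPeriodic : ArcCollection n → Set
  IsPeriodic T = ∃[ i ] ∃[ k ] IsFundamentalDomain T i k

  -- r is the number of bridging arcs of T up to translates.
  NumberOfBridgingArcs : ArcCollection n → ℕ → Set
  NumberOfBridgingArcs T r =
    ∀ k → HasCardinality (λ j → Joined T (upper k) (lower j k)) r

------------------------------------------------------------------------
-- Triangles

  Side : ArcCollection n → Rel (Vertex n) 0ℓ
  Side T u v = Joined T u v ⊎ Neighbours u v

  -- The regions of a periodic triangulation, each given by the list of its
  -- vertices in increasing order for _<∂_; thus different lists are
  -- different regions.
  data IsTriangle (T : ArcCollection n) : List (Vertex n) → Set where
    three-sided : ∀ {u v w} → u <∂ v → v <∂ w →
                  Side T u v → Side T v w → Side T u w →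
                  IsTriangle T (u ∷ v ∷ w ∷ [])
    four-sided  : ∀ {i i′ k} →
                  Joined T (upper k) (lower i k) →
                  Joined T (upper (k ℤ.+ + 1)) (lower i′ (k ℤ.+ + 1)) →
                  Side T (lower i k) (lower i′ (k ℤ.+ + 1)) →
                  IsTriangle T (lower i k ∷ lower i′ (k ℤ.+ + 1) ∷
                                upper (k ℤ.+ + 1) ∷ upper k ∷ [])

  IsQuiddity : ArcCollection n → (Fin n → ℕ) → Set
  IsQuiddity T a =
    ∀ i k → HasCardinality (λ P → IsTriangle T P × lower i k ∈ P) (a i)

------------------------------------------------------------------------
-- Labels

  -- Vertices, with all the upper ones regarded as a single vertex.
  data _≈_ : Rel (Vertex n) 0ℓ where
    same       : ∀ {u} → u ≈ u
    both-upper : ∀ {k l} → upper k ≈ upper l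

  record Corners (P : List (Vertex n)) (u v w : Vertex n) : Set where
    field
      u∈P : u ∈ P
      v∈P : v ∈ P
      w∈P : w ∈ P
      u≉v : ¬ u ≈ v
      u≉w : ¬ u ≈ w
      v≉w : ¬ v ≈ w

  data InitialLabel (T : ArcCollection n) (k : ℤ) : Vertex n → ℕ → Set where
    upper-vertex : ∀ {l} → InitialLabel T k (upper l) 0
    joined       : ∀ {i l} → Joined T (upper k) (lower i l) →
                   InitialLabel T k (lower i l) 1

  -- `LabelAfter T k t w x`: when starting at 0^(k), the vertex w carries the
  -- label x after t rounds.  In each round every vertex w which is not yet
  -- labelled, and which lies in a triangle whose other two vertices are
  -- labelled, is given the sum of their labels.
  LabelAfter : ArcCollection n → ℤ → ℕ → Vertex n → ℕ → Set
  LabelAfter T k zero    w x = InitialLabel T k w x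
  LabelAfter T k (suc t) w x =
    LabelAfter T k t w x ⊎
    ((∀ y → ¬ LabelAfter T k t w y) ×
     (∃[ P ] ∃[ u ] ∃[ v ] ∃[ y ] ∃[ z ]
       IsTriangle T P × Corners P u v w ×
       LabelAfter T k t u y × LabelAfter T k t v z × x ≡ y ℕ.+ z))

  Label : ArcCollection n → ℤ → Vertex n → ℕ → Set
  Label T k w x = ∃[ t ] LabelAfter T k t w x

  AreLabels : ArcCollection n → ℤ → (Fin n → ℕ) → Set
  AreLabels T k label = ∀ i l → Label T k (lower i l) (label i)

------------------------------------------------------------------------
-- Infinite friezes

-- The values of m are only meaningful for j - i ≥ -2; all conditions are
-- restricted to that range.
record IsInfiniteFrieze (m : ℤ → ℤ → ℤ) : Set where
  field
    zeros    : ∀ i → m i (i ℤ.- + 2) ≡ + 0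
    ones     : ∀ i → m i (i ℤ.- + 1) ≡ + 1
    positive : ∀ i j → i ℤ.≤ j → + 0 ℤ.< m i j
    diamond  : ∀ i j → i ℤ.- + 1 ℤ.≤ j →
               m i j ℤ.* m (i ℤ.+ + 1) (j ℤ.+ + 1)
                 ℤ.- m (i ℤ.+ + 1) j ℤ.* m i (j ℤ.+ + 1) ≡ + 1

IsPeriodicFrieze : ℕ → (ℤ → ℤ → ℤ) → Set
IsPeriodicFrieze n m = ∀ i j → i ℤ.≤ j → m i j ≡ m (i ℤ.+ + n) (j ℤ.+ + n)

record IsAssociatedFrieze
         {n : ℕ} (T : ArcCollection n) (m : ℤ → ℤ → ℤ) : Set where
  field
    frieze   : IsInfiniteFrieze m
    periodic : IsPeriodicFrieze n m
    quiddity : ∃[ a ] IsQuiddity T a ×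
               (∀ i → m (+ suc (toℕ i)) (+ suc (toℕ i)) ≡ + a i)

commonDifference : ℕ → (ℤ → ℤ → ℤ) → ℤ → ℕ → ℤ
commonDifference n m i k = m i (j ℤ.+ + n) ℤ.- m i j
  where
  j : ℤ
  j = i ℤ.+ + k ℤ.- + 3

-- The representative of i modulo n in {1,…,n}, as an element of the 0-based
-- type `Fin n`; hence the subtraction of 1.
reduce : ∀ n .{{_ : NonZero n}} → ℤ → Fin n
reduce n i = fromℕ< (n%ℕd<d (i ℤ.- + 1) n)

{-# OPTIONS --safe #-}
module Submission where

-- Write L for the labels and call a function u on the lower vertices a
-- solution if u(x+1) + u(x-1) = a(x) u(x).  Around a lower vertex y the
-- triangles form two fans, joined by one further triangle (or by two, when
-- y is bridging).  Counting them shows that a function is a solution as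
-- soon as u(y) = u(x) + u(z) for all triangles x < y < z and u is an
-- arithmetic progression along the bridging vertices, and conversely.  Hence
-- L is a solution, and so is u = m(i, -); in the numbering of the lower
-- vertices used below, u vanishes at b = i - 2 and is 1 at b + 1.
-- The Wronskian of u and L is constant, so u increases by L(b) between
-- consecutive bridging vertices, hence by r L(b) over a period starting at
-- a bridging vertex.  Therefore u(x+n) - u(x) and r L(b) L(x) are solutions
-- which agree at all bridging vertices, and so everywhere.
open import Defs
open import Data.Empty using (⊥; ⊥-elim)
open import Data.Fin.Base as Fin using (Fin; zero; suc; toℕ; fromℕ<)
open import Data.Fin.Properties as Finₚ using (toℕ<n; toℕ-fromℕ<)
open import Data.Integer.Base as ℤ using (ℤ; +_; _+_; _-_; _*_; pred) renaming (suc to sucℤ)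
open import Data.Integer.DivMod using (_/ℕ_; _%ℕ_; n%ℕd<d; a≡a%ℕn+[a/ℕn]*n)
import Data.Integer.Properties as ℤₚ
open import Data.Integer.Tactic.RingSolver using (solve-∀)
open import Data.List.Base using (List; []; _∷_; _++_; length; head; filter; tabulate; allFin)
open import Data.List.Properties using (length-++)
open import Data.List.Membership.Propositional using (_∈_)
open import Data.List.Membership.Propositional.Properties using (∈-++⁺ˡ; ∈-++⁺ʳ; ∈-++⁻; ∈-allFin; ∈-filter⁺; ∈-filter⁻)
open import Data.List.Membership.Propositional.Properties.WithK using (unique∧set⇒bag)
open import Data.List.Relation.Binary.BagAndSetEquality using (∼bag⇒↭)
open import Data.List.Relation.Binary.Permutation.Propositional.Properties using (↭-length)
open import Data.List.Relation.Unary.All as All using (All)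
open import Data.List.Relation.Unary.AllPairs using ([]; _∷_)
open import Data.List.Relation.Unary.Any using (here; there)
open import Data.List.Relation.Unary.Unique.Propositional using (Unique)
import Data.List.Relation.Unary.Unique.Propositional.Properties as Uniqueₚ
open import Data.Maybe.Base using (just)
open import Data.Maybe.Properties using (just-injective)
open import Data.Nat.Base as ℕ using (ℕ; zero; suc; NonZero; _≤_)
import Data.Nat.Properties as ℕₚ
open import Data.Product.Base using (∃-syntax; _×_; _,_; proj₁; proj₂)
open import Data.Sum.Base using (_⊎_; inj₁; inj₂)
open import Function.Bundles using (mk⇔; module Equivalence)
import Function.Properties.Equivalence as ⇔
open import Relation.Binary.Definitions using (tri<; tri≈; tri>; Decidable; DecidableEquality)
open import Relation.Binary.PropositionalEquality
open import Relation.Nullary using (¬_; Dec; yes; no; contradiction)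
open import Relation.Nullary.Decidable using (map′; _×-dec_; _⊎-dec_)
open import Relation.Unary using () renaming (Decidable to Decidable₁)

-- Counting becomes algebra through the dual tree of the polygon under an edge: the triangles at an
-- end of the edge form a spine of this tree, and an identity valid at each node telescopes along
-- the spine. Two inputs have to be earned first. Maximality speaks about all larger collections, so
-- an edge is obtained from it by showing that a candidate chord crosses nothing. Labels are
-- specified by rounds, and translates of a vertex may be labelled in different rounds, so the order
-- of labelling has to be controlled before additivity over triangles can be read off. The row m(i,
-- -) is meaningful only from b on, so statements about general solutions carry a lower bound `b`.
-- Agreement at both ends of a single edge is already enough: the fan identity turns those ends into
-- two adjacent vertices, where a second-order recurrence is determined.

i<suc[i] : ∀ x → x ℤ.< sucℤ x
i<suc[i] x = ℤₚ.suc[i]≤j⇒i<j ℤₚ.≤-refl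

none-between : ∀ {x y} → x ℤ.< y → ¬ y ℤ.< sucℤ x
none-between x<y y<sx = ℤₚ.<-irrefl refl (ℤₚ.<-≤-trans y<sx (ℤₚ.i<j⇒suc[i]≤j x<y))

<suc⇒≤ : ∀ {x y} → x ℤ.< sucℤ y → x ℤ.≤ y
<suc⇒≤ x<sy = ℤₚ.≮⇒≥ (λ y<x → none-between y<x x<sy)

≤⇒<⊎≡ : ∀ {x y} → x ℤ.≤ y → x ℤ.< y ⊎ x ≡ y
≤⇒<⊎≡ {x} {y} x≤y with ℤₚ.<-cmp x y
... | tri< x<y _ _ = inj₁ x<y
... | tri≈ _ x≡y _ = inj₂ x≡y
... | tri> _ _ y<x = contradiction y<x (ℤₚ.≤⇒≯ x≤y)

infixl 6 _⊕_

_⊕_ : ℤ → ℕ → ℤ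
x ⊕ zero  = x
x ⊕ suc t = sucℤ (x ⊕ t)

⊕≡+ : ∀ x t → x ⊕ t ≡ x + + t
⊕≡+ x zero    = sym (ℤₚ.+-identityʳ x)
⊕≡+ x (suc t) = trans (cong sucℤ (⊕≡+ x t)) (lemma x (+ t))
  where
  lemma : ∀ a b → + 1 + (a + b) ≡ a + (+ 1 + b)
  lemma = solve-∀

abstract
  ≤⇒⊕ : ∀ {x y} → x ℤ.≤ y → ∃[ t ] y ≡ x ⊕ t
  ≤⇒⊕ {x} {y} x≤y = ℤ.∣ y - x ∣ , (begin
    y                      ≡⟨ lemma x y ⟩
    x + (y - x)            ≡⟨ cong (_+_ x) (ℤₚ.0≤i⇒+∣i∣≡i (ℤₚ.i≤j⇒0≤j-i x≤y)) ⟨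
    x + + ℤ.∣ y - x ∣      ≡⟨ ⊕≡+ x ℤ.∣ y - x ∣ ⟨
    x ⊕ ℤ.∣ y - x ∣        ∎)
    where
    open ≡-Reasoning
    lemma : ∀ a b → b ≡ a + (b - a)
    lemma = solve-∀

x≤x⊕t : ∀ x t → x ℤ.≤ x ⊕ t
x≤x⊕t x zero    = ℤₚ.≤-refl
x≤x⊕t x (suc t) = ℤₚ.≤-trans (x≤x⊕t x t) (ℤₚ.i≤suc[i] _)

-- Bounded search in the integers

module _ {P : ℤ → Set} (P? : Decidable₁ P) where

  last-in : ∀ x t →
    (∃[ s ] x ℤ.≤ s × s ℤ.< x ⊕ t × P s × (∀ z → s ℤ.< z → z ℤ.< x ⊕ t → ¬ P z)) ⊎
    (∀ z → x ℤ.≤ z → z ℤ.< x ⊕ t → ¬ P z)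
  last-in x zero = inj₂ λ z x≤z z<x _ → ℤₚ.<-irrefl refl (ℤₚ.≤-<-trans x≤z z<x)
  last-in x (suc t) with P? (x ⊕ t)
  ... | yes p = inj₁ (x ⊕ t , x≤x⊕t x t , i<suc[i] _ , p , λ z s<z z<s _ → none-between s<z z<s)
  ... | no ¬p with last-in x t
  ...   | inj₁ (s , x≤s , s<y , p , none) =
    inj₁ (s , x≤s , ℤₚ.<-trans s<y (i<suc[i] _) , p , λ z s<z z<y → below z s<z (≤⇒<⊎≡ (<suc⇒≤ z<y)))
    where
    below : ∀ z → s ℤ.< z → z ℤ.< x ⊕ t ⊎ z ≡ x ⊕ t → ¬ P z
    below z s<z (inj₁ z<)   = none z s<z z<
    below z s<z (inj₂ refl) = ¬p
  ...   | inj₂ none = inj₂ λ z x≤z z<y → below z x≤z (≤⇒<⊎≡ (<suc⇒≤ z<y))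
    where
    below : ∀ z → x ℤ.≤ z → z ℤ.< x ⊕ t ⊎ z ≡ x ⊕ t → ¬ P z
    below z x≤z (inj₁ z<)   = none z x≤z z<
    below z x≤z (inj₂ refl) = ¬p

  last-below : ∀ {x y} → P x → x ℤ.< y →
    ∃[ s ] x ℤ.≤ s × s ℤ.< y × P s × (∀ z → s ℤ.< z → z ℤ.< y → ¬ P z)
  last-below {x} px x<y with ≤⇒⊕ (ℤₚ.<⇒≤ x<y)
  ... | t , refl with last-in x t
  ...   | inj₁ found = found
  ...   | inj₂ none  = contradiction px (none x ℤₚ.≤-refl x<y)

  first-in : ∀ x t →
    (∃[ s ] x ℤ.≤ s × s ℤ.< x ⊕ t × P s × (∀ z → x ℤ.≤ z → z ℤ.< s → ¬ P z)) ⊎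
    (∀ z → x ℤ.≤ z → z ℤ.< x ⊕ t → ¬ P z)
  first-in x zero = inj₂ λ z x≤z z<x _ → ℤₚ.<-irrefl refl (ℤₚ.≤-<-trans x≤z z<x)
  first-in x (suc t) with first-in x t
  ... | inj₁ (s , x≤s , s<y , p , none) = inj₁ (s , x≤s , ℤₚ.<-trans s<y (i<suc[i] _) , p , none)
  ... | inj₂ none with P? (x ⊕ t)
  ...   | yes p = inj₁ (x ⊕ t , x≤x⊕t x t , i<suc[i] _ , p , none)
  ...   | no ¬p = inj₂ λ z x≤z z<y → below z x≤z (≤⇒<⊎≡ (<suc⇒≤ z<y))
    where
    below : ∀ z → x ℤ.≤ z → z ℤ.< x ⊕ t ⊎ z ≡ x ⊕ t → ¬ P z
    below z x≤z (inj₁ z<)   = none z x≤z z<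
    below z x≤z (inj₂ refl) = ¬p

  first-from : ∀ {x y} → P y → x ℤ.≤ y →
    ∃[ s ] x ℤ.≤ s × s ℤ.≤ y × P s × (∀ z → x ℤ.≤ z → z ℤ.< s → ¬ P z)
  first-from {x} py x≤y with ≤⇒⊕ x≤y
  ... | t , refl with first-in x (suc t)
  ...   | inj₁ (s , x≤s , s<sy , p , none) = s , x≤s , <suc⇒≤ s<sy , p , none
  ...   | inj₂ none  = contradiction py (none _ x≤y (i<suc[i] _))

-- Cutting off the left end of an interval lowers the bound on its length by one; this is the
-- decrease for the right half in `Edge⇒Tree`.
⊕-mono-< : ∀ {x y} d → x ℤ.< y → sucℤ (x ⊕ d) ℤ.≤ y ⊕ d
⊕-mono-< zero    x<y = ℤₚ.i<j⇒suc[i]≤j x<y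
⊕-mono-< (suc d) x<y = ℤₚ.suc-mono (⊕-mono-< d x<y)

-- Cardinalities and telescoping sums

cardinality-unique : ∀ {A : Set} {Q : A → Set} {c d} →
  HasCardinality Q c → HasCardinality Q d → c ≡ d
cardinality-unique (xs , xs! , xs⇔ , refl) (ys , ys! , ys⇔ , refl) =
  ↭-length (∼bag⇒↭ (unique∧set⇒bag xs! ys! λ {x} → ⇔.trans (xs⇔ x) (⇔.sym (ys⇔ x))))

filter-cardinality : ∀ {n c} {Q : Fin n → Set} (Q? : Decidable₁ Q) →
  HasCardinality Q c → length (filter Q? (allFin n)) ≡ c
filter-cardinality {n} Q? card = cardinality-unique
  (filter Q? (allFin n) , Uniqueₚ.filter⁺ Q? (Uniqueₚ.allFin⁺ n)
  , (λ x → mk⇔ (λ p → proj₂ (∈-filter⁻ Q? {xs = allFin n} p)) (∈-filter⁺ Q? (∈-allFin x))) , refl)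
  card

-- `e` and `g` vary together in the induction, because the tail of `tabulate e` enumerates by `e`
-- after `suc` and meets `g` one step later.
telescope : ∀ {A : Set} {Q : A → Set} (Q? : Decidable₁ Q) (δ : ℤ) n (e : Fin n → A) (g : ℕ → ℤ) →
  (∀ i → Q (e i) → g (suc (toℕ i)) ≡ g (toℕ i) + δ) →
  (∀ i → ¬ Q (e i) → g (suc (toℕ i)) ≡ g (toℕ i)) →
  g n ≡ g 0 + + length (filter Q? (tabulate e)) * δ
telescope Q? δ zero e g up stay = lemma (g 0) δ
  where
  lemma : ∀ a d → a ≡ a + + 0 * d
  lemma = solve-∀
telescope Q? δ (suc n) e g up stay
  with Q? (e zero)
     | telescope Q? δ n (λ i → e (suc i)) (λ t → g (suc t)) (λ i → up (suc i)) (λ i → stay (suc i))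
... | yes q | rest = trans rest (trans (cong (λ v → v + + c * δ) (up zero q)) (lemma (g 0) (+ c) δ))
  where
  c = length (filter Q? (tabulate (λ i → e (suc i))))
  lemma : ∀ a c d → a + d + c * d ≡ a + (+ 1 + c) * d
  lemma = solve-∀
... | no ¬q | rest = trans rest (cong (λ v → v + + c * δ) (stay zero ¬q))
  where
  c = length (filter Q? (tabulate (λ i → e (suc i))))

-- The lower vertices as integers

module Strip (n : ℕ) .{{n≢0 : NonZero n}} where

  pos : Fin n → ℤ → ℤ
  pos i k = + toℕ i + k * + n

  -- Kept abstract so that x can be inferred from idx x and sup x.
  abstract
    idx : ℤ → Fin n
    idx x = fromℕ< (n%ℕd<d x n)

    sup : ℤ → ℤ
    sup x = x /ℕ n

    pos-vtx : ∀ x → pos (idx x) (sup x) ≡ x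
    pos-vtx x = begin
      + toℕ (idx x) + sup x * + n ≡⟨ cong (λ t → + t + sup x * + n) (toℕ-fromℕ< (n%ℕd<d x n)) ⟩
      + (x %ℕ n) + sup x * + n    ≡⟨ a≡a%ℕn+[a/ℕn]*n x n ⟨
      x                           ∎
      where open ≡-Reasoning

    -- The subtraction of 1 is the shift between the numbering in the frieze and that of `vtx`. The
    -- equation is recorded here because `idx` unfolds only inside `abstract`.
    reduce≡idx : ∀ x → reduce n x ≡ idx (x - + 1)
    reduce≡idx x = refl

  -- The lower vertices are numbered from left to right so that 1^(0) is
  -- vtx (+ 0); a vertex written i in the frieze is thus vtx (i - + 1).
  vtx : ℤ → Vertex n
  vtx x = lower (idx x) (sup x)

  <∂⇒pos< : ∀ {i j k l} → lower i k <∂ lower j l → pos i k ℤ.< pos j l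
  <∂⇒pos< {i} {j} {k} {l} (lower-block k<l) = begin-strict
    + toℕ i + k * + n  <⟨ ℤₚ.+-monoˡ-< (k * + n) (ℤ.+<+ (toℕ<n i)) ⟩
    + n + k * + n      ≡⟨ ℤₚ.suc-* k (+ n) ⟨
    sucℤ k * + n       ≤⟨ ℤₚ.*-monoʳ-≤-nonNeg (+ n) (ℤₚ.i<j⇒suc[i]≤j k<l) ⟩
    l * + n            ≤⟨ ℤₚ.i≤j+i _ (+ toℕ j) ⟩
    + toℕ j + l * + n  ∎
    where open ℤₚ.≤-Reasoning
  <∂⇒pos< {k = k} (lower-index i<j) = ℤₚ.+-monoˡ-< (k * + n) (ℤ.+<+ i<j)

  lower-cmp : ∀ (i : Fin n) k (j : Fin n) l →
    lower i k <∂ lower j l ⊎ (i ≡ j × k ≡ l) ⊎ lower j l <∂ lower i k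
  lower-cmp i k j l with ℤₚ.<-cmp k l
  ... | tri< k<l _ _ = inj₁ (lower-block k<l)
  ... | tri> _ _ l<k = inj₂ (inj₂ (lower-block l<k))
  ... | tri≈ _ refl _ with Finₚ.<-cmp i j
  ...   | tri< i<j _ _ = inj₁ (lower-index i<j)
  ...   | tri≈ _ i≡j _ = inj₂ (inj₁ (i≡j , refl))
  ...   | tri> _ _ j<i = inj₂ (inj₂ (lower-index j<i))

  pos-injective : ∀ {i k j l} → pos i k ≡ pos j l → i ≡ j × k ≡ l
  pos-injective {i} {k} {j} {l} eq with lower-cmp i k j l
  ... | inj₁ lt        = contradiction (<∂⇒pos< lt) (ℤₚ.<-irrefl eq)
  ... | inj₂ (inj₁ e)  = e
  ... | inj₂ (inj₂ gt) = contradiction (<∂⇒pos< gt) (ℤₚ.<-irrefl (sym eq))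

  vtx-pos : ∀ i k → vtx (pos i k) ≡ lower i k
  vtx-pos i k with pos-injective {idx (pos i k)} {sup (pos i k)} {i} {k} (pos-vtx (pos i k))
  ... | p , q = cong₂ lower p q

  vtx≡⇒≡pos : ∀ {x i k} → vtx x ≡ lower i k → x ≡ pos i k
  vtx≡⇒≡pos {x} refl = sym (pos-vtx x)

  vtx-injective : ∀ {x y} → vtx x ≡ vtx y → x ≡ y
  vtx-injective {x} {y} eq = trans (vtx≡⇒≡pos eq) (pos-vtx y)

  <∂⇒< : ∀ {x y} → vtx x <∂ vtx y → x ℤ.< y
  <∂⇒< {x} {y} lt = subst₂ ℤ._<_ (pos-vtx x) (pos-vtx y) (<∂⇒pos< lt)

  <⇒<∂ : ∀ {x y} → x ℤ.< y → vtx x <∂ vtx y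
  <⇒<∂ {x} {y} x<y with lower-cmp (idx x) (sup x) (idx y) (sup y)
  ... | inj₁ lt             = lt
  ... | inj₂ (inj₁ (p , q)) = contradiction x<y (ℤₚ.<-irrefl (vtx-injective (cong₂ lower p q)))
  ... | inj₂ (inj₂ gt)      = contradiction x<y (ℤₚ.<-asym (<∂⇒< gt))

  -- Matching on this view replaces an index and a superscript by one integer, without transporting
  -- proofs along `vtx-pos`.
  data LowerView : Vertex n → Set where
    at : ∀ x → LowerView (vtx x)

  lower-view : ∀ i k → LowerView (lower i k)
  lower-view i k = subst LowerView (vtx-pos i k) (at (pos i k))

  pos-next : ∀ {i j} k → toℕ j ≡ suc (toℕ i) → pos j k ≡ sucℤ (pos i k)
  pos-next {i} k eq = trans (cong (λ t → + t + k * + n) eq) (ℤₚ.suc-+ (toℕ i) (k * + n))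

  pos-wrap : ∀ {i j} k → suc (toℕ i) ≡ n → toℕ j ≡ 0 → pos j (k + + 1) ≡ sucℤ (pos i k)
  pos-wrap {i} {j} k i+1≡n j≡0 = begin
    + toℕ j + (k + + 1) * + n   ≡⟨ cong (λ t → + t + (k + + 1) * + n) j≡0 ⟩
    + 0 + (k + + 1) * + n       ≡⟨ lemma k (+ n) ⟩
    + n + k * + n               ≡⟨ cong (λ t → + t + k * + n) i+1≡n ⟨
    + suc (toℕ i) + k * + n     ≡⟨ ℤₚ.suc-+ (toℕ i) (k * + n) ⟩
    sucℤ (pos i k)              ∎
    where
    open ≡-Reasoning
    lemma : ∀ k n → + 0 + (k + + 1) * n ≡ n + k * n
    lemma = solve-∀

  ⋖⇒suc : ∀ {x y} → vtx x ⋖ vtx y → y ≡ sucℤ x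
  ⋖⇒suc {x} {y} x⋖y = trans (sym (pos-vtx y)) (trans (go x⋖y) (cong sucℤ (pos-vtx x)))
    where
    go : ∀ {i k j l} → lower i k ⋖ lower j l → pos j l ≡ sucℤ (pos i k)
    go {i} {k} {j} (lower-next j≡i+1)  = pos-next {i} {j} k j≡i+1
    go {i} {k} {j} (lower-wrap i≡ j≡0) = pos-wrap {i} {j} k i≡ j≡0

  suc-⋖ : ∀ x → vtx x ⋖ vtx (sucℤ x)
  suc-⋖ x with ℕₚ.m≤n⇒m<n∨m≡n (toℕ<n (idx x))
  ... | inj₁ lt = subst (vtx x ⋖_) vtx-next (lower-next (toℕ-fromℕ< lt))
    where
    vtx-next : lower (fromℕ< lt) (sup x) ≡ vtx (sucℤ x)
    vtx-next = trans (sym (vtx-pos _ _)) (cong vtx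
      (trans (pos-next {idx x} {fromℕ< lt} (sup x) (toℕ-fromℕ< lt)) (cong sucℤ (pos-vtx x))))
  ... | inj₂ eq = subst (vtx x ⋖_) vtx-next (lower-wrap eq (toℕ-fromℕ< 0<n))
    where
    0<n : 0 ℕ.< n
    0<n = ℕ.>-nonZero⁻¹ n
    vtx-next : lower (fromℕ< 0<n) (sup x + + 1) ≡ vtx (sucℤ x)
    vtx-next = trans (sym (vtx-pos _ _)) (cong vtx
      (trans (pos-wrap {idx x} {fromℕ< 0<n} (sup x) eq (toℕ-fromℕ< 0<n)) (cong sucℤ (pos-vtx x))))

  vtx-+n : ∀ x → vtx (x + + n) ≡ lower (idx x) (sup x + + 1)
  vtx-+n x = trans (cong vtx (trans (cong (λ t → t + + n) (sym (pos-vtx x))) (lemma (+ toℕ (idx x)) (sup x) (+ n))))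
                   (vtx-pos (idx x) (sup x + + 1))
    where
    lemma : ∀ i k n → i + k * n + n ≡ i + (k + + 1) * n
    lemma = solve-∀

  sup-mono : ∀ {x y} → x ℤ.≤ y → sup x ℤ.≤ sup y
  sup-mono {x} {y} x≤y = ℤₚ.≮⇒≥ λ sy<sx → ℤₚ.<-irrefl refl (ℤₚ.<-≤-trans (<∂⇒< (lower-block sy<sx)) x≤y)

  <∂-irrefl : ∀ {u : Vertex n} → ¬ u <∂ u
  <∂-irrefl (lower-block k<k) = ℤₚ.<-irrefl refl k<k
  <∂-irrefl (lower-index i<i) = Finₚ.<-irrefl refl i<i
  <∂-irrefl (upper-upper k<k) = ℤₚ.<-irrefl refl k<k

  <∂-trans : ∀ {u v w : Vertex n} → u <∂ v → v <∂ w → u <∂ w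
  <∂-trans (lower-block p) (lower-block q) = lower-block (ℤₚ.<-trans p q)
  <∂-trans (lower-block p) (lower-index q) = lower-block p
  <∂-trans (lower-index p) (lower-block q) = lower-block q
  <∂-trans (lower-index p) (lower-index q) = lower-index (Finₚ.<-trans p q)
  <∂-trans (lower-block _) lower-upper     = lower-upper
  <∂-trans (lower-index _) lower-upper     = lower-upper
  <∂-trans lower-upper     (upper-upper _) = lower-upper
  <∂-trans (upper-upper p) (upper-upper q) = upper-upper (ℤₚ.<-trans q p)

  _≟ᵥ_ : DecidableEquality (Vertex n)
  upper k   ≟ᵥ upper l   = map′ (cong upper) (λ { refl → refl }) (k ℤₚ.≟ l)
  upper k   ≟ᵥ lower j l = no λ ()
  lower i k ≟ᵥ upper l   = no λ ()
  lower i k ≟ᵥ lower j l =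
    map′ (λ { (refl , refl) → refl }) (λ { refl → refl , refl }) ((i Finₚ.≟ j) ×-dec (k ℤₚ.≟ l))

-- Edges, triangles and dual trees on the lower boundary

module Triangulated (n : ℕ) .{{n≢0 : NonZero n}} (T : ArcCollection n)
  (triangulation : IsTriangulation T) (periodic : IsPeriodic T) where

  open Strip n
  open IsTriangulation triangulation

  Arc : ℤ → ℤ → Set
  Arc x y = Joined T (vtx x) (vtx y)

  Arc? : Decidable Arc
  Arc? x y = joined? T (vtx x) (vtx y)

  -- Condition A3 leaves `upper (sup x)` as the only upper vertex that `vtx x` can be joined with.
  Bridge : ℤ → Set
  Bridge x = Joined T (upper (sup x)) (vtx x)

  Bridge? : ∀ x → Dec (Bridge x)
  Bridge? x = joined? T (upper (sup x)) (vtx x)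

  Edge : ℤ → ℤ → Set
  Edge x y = y ≡ sucℤ x ⊎ Arc x y

  Edge? : Decidable Edge
  Edge? x y = (y ℤₚ.≟ sucℤ x) ⊎-dec Arc? x y

  bridge-sup : ∀ {k i l} → Joined T (upper k) (lower i l) → k ≡ l
  bridge-sup j = IsArc.A3 (joined-arc T j) (inj₁ (upper _))

  to-Bridge : ∀ {k x} → Joined T (upper k) (vtx x) → Bridge x
  to-Bridge {k} {x} j = subst (λ l → Joined T (upper l) (vtx x)) (bridge-sup j) j

  Arc-cross : ∀ {x y z w} → Arc x z → Arc y w → x ℤ.< y → y ℤ.< z → z ℤ.< w → ⊥
  Arc-cross xz yw x<y y<z z<w = nonCrossing xz yw (<⇒<∂ x<y , <⇒<∂ y<z , <⇒<∂ z<w)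

  Arc-Bridge : ∀ {x y z} → Arc x z → Bridge y → x ℤ.< y → y ℤ.< z → ⊥
  Arc-Bridge xz by x<y y<z = nonCrossing xz (joined-sym T by) (<⇒<∂ x<y , <⇒<∂ y<z , lower-upper)

  Edge⇒Arc : ∀ {x y z} → Edge x z → x ℤ.< y → y ℤ.< z → Arc x z
  Edge⇒Arc (inj₁ refl) x<y y<z = ⊥-elim (none-between x<y y<z)
  Edge⇒Arc (inj₂ j)    x<y y<z = j

  Edge-cross : ∀ {x y z w} → Edge x z → Edge y w → x ℤ.< y → y ℤ.< z → z ℤ.< w → ⊥
  Edge-cross xz yw x<y y<z z<w = Arc-cross (Edge⇒Arc xz x<y y<z) (Edge⇒Arc yw y<z z<w) x<y y<z z<w

  Edge-Bridge : ∀ {x y z} → Edge x z → Bridge y → x ℤ.< y → y ℤ.< z → ⊥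
  Edge-Bridge xz by x<y y<z = Arc-Bridge (Edge⇒Arc xz x<y y<z) by x<y y<z

  Edge⇒Side : ∀ {x y} → Edge x y → Side T (vtx x) (vtx y)
  Edge⇒Side {x} (inj₁ refl) = inj₂ (inj₁ (suc-⋖ x))
  Edge⇒Side     (inj₂ j)    = inj₁ j

  Side⇒Edge : ∀ {x y} → x ℤ.< y → Side T (vtx x) (vtx y) → Edge x y
  Side⇒Edge x<y (inj₁ j)           = inj₂ j
  Side⇒Edge x<y (inj₂ (inj₁ x⋖y)) = inj₁ (⋖⇒suc x⋖y)
  Side⇒Edge {x} {y} x<y (inj₂ (inj₂ y⋖x)) =
    contradiction x<y (ℤₚ.<-asym (subst (y ℤ.<_) (sym (⋖⇒suc y⋖x)) (i<suc[i] y)))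

  -- The only use of maximality: T enlarged by this one arc, in both orientations, is still
  -- noncrossing. An arc alternating with x and y has one end strictly between them; its other end
  -- is lower on the left (`left`), lower on the right (`right`) or upper (`above`).
  add-arc : ∀ {x y} → x ℤ.< y → y ≢ sucℤ x →
    (∀ {a c} → Arc a c → a ℤ.< x → x ℤ.< c → c ℤ.< y → ⊥) →
    (∀ {a c} → Arc a c → x ℤ.< a → a ℤ.< y → y ℤ.< c → ⊥) →
    (∀ {z} → Bridge z → x ℤ.< z → z ℤ.< y → ⊥) →
    Arc x y
  add-arc {x} {y} x<y y≢sx left right above =
    maximal T′ nonCrossing′ inj₁ (inj₂ (inj₁ (refl , refl)))
    where
    New : Vertex n → Vertex n → Set
    New u v = (u ≡ vtx x × v ≡ vtx y) ⊎ (u ≡ vtx y × v ≡ vtx x)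

    xy-arc : IsArc (vtx x) (vtx y)
    xy-arc = record
      { A1 = inj₁ (lower _ _)
      ; A2 = (λ eq → ℤₚ.<-irrefl (vtx-injective eq) x<y)
           , λ { (inj₁ x⋖y) → y≢sx (⋖⇒suc x⋖y)
               ; (inj₂ y⋖x) → ℤₚ.<-asym x<y (subst (y ℤ.<_) (sym (⋖⇒suc y⋖x)) (i<suc[i] y)) }
      ; A3 = λ { (inj₁ ()) ; (inj₂ ()) }
      }

    yx-arc : IsArc (vtx y) (vtx x)
    yx-arc = record
      { A1 = inj₁ (lower _ _)
      ; A2 = (λ eq → proj₁ (IsArc.A2 xy-arc) (sym eq))
           , λ { (inj₁ p) → proj₂ (IsArc.A2 xy-arc) (inj₂ p)
               ; (inj₂ p) → proj₂ (IsArc.A2 xy-arc) (inj₁ p) }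
      ; A3 = λ { (inj₁ ()) ; (inj₂ ()) }
      }

    T′ : ArcCollection n
    T′ = record
      { Joined     = λ u v → Joined T u v ⊎ New u v
      ; joined?    = λ u v → joined? T u v ⊎-dec
          (((u ≟ᵥ vtx x) ×-dec (v ≟ᵥ vtx y)) ⊎-dec ((u ≟ᵥ vtx y) ×-dec (v ≟ᵥ vtx x)))
      ; joined-sym = λ { (inj₁ j) → inj₁ (joined-sym T j)
                       ; (inj₂ (inj₁ (p , q))) → inj₂ (inj₂ (q , p))
                       ; (inj₂ (inj₂ (p , q))) → inj₂ (inj₁ (q , p)) }
      ; joined-arc = λ { (inj₁ j) → joined-arc T j
                       ; (inj₂ (inj₁ (refl , refl))) → xy-arc
                       ; (inj₂ (inj₂ (refl , refl))) → yx-arc }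
      }

    new-old : ∀ {u v} → Joined T u v → ¬ Alternate (vtx x) (vtx y) u v
    new-old {lower i k} {lower j l} uv (x<u , u<y , y<v) with lower-view i k | lower-view j l
    ... | at a | at c = right uv (<∂⇒< x<u) (<∂⇒< u<y) (<∂⇒< y<v)
    new-old {lower i k} {upper l} uv (x<u , u<y , y<v) with lower-view i k
    ... | at a = above (to-Bridge (joined-sym T uv)) (<∂⇒< x<u) (<∂⇒< u<y)

    old-new : ∀ {u v} → Joined T u v → ¬ Alternate u v (vtx x) (vtx y)
    old-new {lower i k} {lower j l} uv (u<x , x<v , v<y) with lower-view i k | lower-view j l
    ... | at a | at c = left uv (<∂⇒< u<x) (<∂⇒< x<v) (<∂⇒< v<y)

    y≮x : ¬ vtx y <∂ vtx x
    y≮x y<x = ℤₚ.<-asym x<y (<∂⇒< y<x)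

    nonCrossing′ : NonCrossing T′
    nonCrossing′ (inj₁ j) (inj₁ k) alt = nonCrossing j k alt
    nonCrossing′ (inj₁ j) (inj₂ (inj₁ (refl , refl))) alt = old-new j alt
    nonCrossing′ (inj₁ j) (inj₂ (inj₂ (refl , refl))) (_ , y<v , v<x) = y≮x (<∂-trans y<v v<x)
    nonCrossing′ (inj₂ (inj₁ (refl , refl))) (inj₁ k) alt = new-old k alt
    nonCrossing′ (inj₂ (inj₂ (refl , refl))) (inj₁ k) (y<u , u<x , _) = y≮x (<∂-trans y<u u<x)
    nonCrossing′ (inj₂ (inj₁ (refl , refl))) (inj₂ (inj₁ (refl , refl))) (x<x , _) = <∂-irrefl x<x
    nonCrossing′ (inj₂ (inj₁ (refl , refl))) (inj₂ (inj₂ (refl , refl))) (_ , y<y , _) = <∂-irrefl y<y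
    nonCrossing′ (inj₂ (inj₂ (refl , refl))) (inj₂ (inj₁ (refl , refl))) (y<x , _) = y≮x y<x
    nonCrossing′ (inj₂ (inj₂ (refl , refl))) (inj₂ (inj₂ (refl , refl))) (y<y , _) = <∂-irrefl y<y

  record Tri (x y z : ℤ) : Set where
    constructor mkTri
    field
      x<y : x ℤ.< y
      y<z : y ℤ.< z
      xy  : Edge x y
      yz  : Edge y z
      xz  : Edge x z

  -- The apex is the last vertex before z that has an edge from x; the neighbour x + 1 is a first
  -- candidate. An arc crossing y z would cross x z or x y, or start at x and contradict the choice
  -- of y, so `add-arc` yields the third side.
  apex : ∀ {x z} → x ℤ.< z → Arc x z → ∃[ y ] Tri x y z
  apex {x} {z} x<z xz = y , mkTri x<y y<z xy yz (inj₂ xz)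
    where
    sx<z : sucℤ x ℤ.< z
    sx<z with ≤⇒<⊎≡ (ℤₚ.i<j⇒suc[i]≤j x<z)
    ... | inj₁ lt   = lt
    ... | inj₂ refl = ⊥-elim (proj₂ (IsArc.A2 (joined-arc T xz)) (inj₁ (suc-⋖ x)))
    last = last-below (Edge? x) {sucℤ x} (inj₁ refl) sx<z
    y = proj₁ last
    x<y : x ℤ.< y
    x<y = ℤₚ.suc[i]≤j⇒i<j (proj₁ (proj₂ last))
    y<z : y ℤ.< z
    y<z = proj₁ (proj₂ (proj₂ last))
    xy : Edge x y
    xy = proj₁ (proj₂ (proj₂ (proj₂ last)))
    none : ∀ w → y ℤ.< w → w ℤ.< z → ¬ Edge x w
    none = proj₂ (proj₂ (proj₂ (proj₂ last)))
    left : ∀ {a c} → Arc a c → a ℤ.< y → y ℤ.< c → c ℤ.< z → ⊥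
    left {a} {c} ac a<y y<c c<z with ℤₚ.<-cmp a x
    ... | tri< a<x _ _  = Arc-cross ac xz a<x (ℤₚ.<-trans x<y y<c) c<z
    ... | tri≈ _ refl _ = none c y<c c<z (inj₂ ac)
    ... | tri> _ _ x<a  = Edge-cross xy (inj₂ ac) x<a a<y y<c
    yz : Edge y z
    yz with z ℤₚ.≟ sucℤ y
    ... | yes z≡sy = inj₁ z≡sy
    ... | no  z≢sy = inj₂ (add-arc y<z z≢sy left
      (λ ac y<a a<z z<c → Arc-cross xz ac (ℤₚ.<-trans x<y y<a) a<z z<c)
      (λ bw y<w w<z → Arc-Bridge xz bw (ℤₚ.<-trans x<y y<w) w<z))

  -- The dual tree of the triangulated polygon cut off by an edge; its leaves are boundary segments.
  data Tree : ℤ → ℤ → Set where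
    leaf : ∀ x → Tree x (sucℤ x)
    node : ∀ {x y z} → Arc x z → Tree x y → Tree y z → Tree x z

  tree-< : ∀ {x z} → Tree x z → x ℤ.< z
  tree-< (leaf x)     = i<suc[i] x
  tree-< (node _ l r) = ℤₚ.<-trans (tree-< l) (tree-< r)

  tree-Edge : ∀ {x z} → Tree x z → Edge x z
  tree-Edge (leaf x)     = inj₁ refl
  tree-Edge (node j _ _) = inj₂ j

  node-Tri : ∀ {x y z} → Arc x z → Tree x y → Tree y z → Tri x y z
  node-Tri j l r = mkTri (tree-< l) (tree-< r) (tree-Edge l) (tree-Edge r) (inj₂ j)

  Edge⇒Tree : ∀ {x z} → x ℤ.< z → Edge x z → Tree x z
  Edge⇒Tree {x} x<z s with ≤⇒⊕ (ℤₚ.<⇒≤ x<z)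
  ... | d , refl = build d x<z ℤₚ.≤-refl s
    where
    -- `d` bounds the length of the interval, and both sides of the apex are strictly shorter.
    build : ∀ d {x z} → x ℤ.< z → z ℤ.≤ x ⊕ d → Edge x z → Tree x z
    build zero    x<z z≤x _ = contradiction x<z (ℤₚ.≤⇒≯ z≤x)
    build (suc d) x<z z≤ (inj₁ refl) = leaf _
    build (suc d) x<z z≤ (inj₂ j) with apex x<z j
    ... | y , mkTri x<y y<z xy yz _ =
      node j (build d x<y (<suc⇒≤ (ℤₚ.<-≤-trans y<z z≤)) xy)
             (build d y<z (ℤₚ.≤-trans z≤ (⊕-mono-< d x<y)) yz)

  data Middle (y : ℤ) : Set where
    middle : ∀ {x z} → Arc x z → Tree x y → Tree y z → Middle y

  -- Every vertex strictly inside the interval is the apex of some node: descend into the half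
  -- containing it until it is the splitting vertex.
  find-middle : ∀ {x y z} → Tree x z → x ℤ.< y → y ℤ.< z → Middle y
  find-middle (leaf x) x<y y<z = ⊥-elim (none-between x<y y<z)
  find-middle {y = y} (node {y = w} j l r) x<y y<z with ℤₚ.<-cmp y w
  ... | tri< y<w _ _  = find-middle l x<y y<w
  ... | tri≈ _ refl _ = middle j l r
  ... | tri> _ _ w<y  = find-middle r w<y y<z

  -- Translation invariance and bridging vertices

  shift-shift : ∀ s t (u : Vertex n) → shift s (shift t u) ≡ shift (t + s) u
  shift-shift s t (upper k)   = cong upper (ℤₚ.+-assoc k t s)
  shift-shift s t (lower i k) = cong (lower i) (ℤₚ.+-assoc k t s)

  i₀ : Fin n
  i₀ = proj₁ periodic

  k₀ : ℤ
  k₀ = proj₁ (proj₂ periodic)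

  open IsFundamentalDomain (proj₂ (proj₂ periodic))

  -- `covered` presents the arcs as all translates of the arcs in the polygon, so a further shift
  -- only changes the amount from t to t + s.
  joined-shift : ∀ s {u v} → Joined T u v → Joined T (shift s u) (shift s v)
  joined-shift s {u} {v} j with Equivalence.to (covered u v) j
  ... | t , u₀ , v₀ , u₀∈ , v₀∈ , j₀ , refl , refl =
    Equivalence.from (covered _ _)
      (t + s , u₀ , v₀ , u₀∈ , v₀∈ , j₀ , shift-shift s t u₀ , shift-shift s t v₀)

  joined-Bridge : ∀ {i k} → Joined T (upper k) (lower i k) → Bridge (pos i k)
  joined-Bridge {i} {k} j = subst (λ v → Joined T (upper (superscript v)) v) (sym (vtx-pos i k)) j

  Bridge-joined : ∀ {i k} → Bridge (pos i k) → Joined T (upper k) (lower i k)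
  Bridge-joined {i} {k} = subst (λ v → Joined T (upper (superscript v)) v) (vtx-pos i k)

  -- A bridging vertex in every block bounds the searches for the next and the previous bridging
  -- vertex.
  Bridge₀ : ∀ k → Bridge (pos i₀ k)
  Bridge₀ k = joined-Bridge (subst (λ l → Joined T (upper l) (lower i₀ l)) (lemma k₀ k) (joined-shift (k - k₀) left-side))
    where
    lemma : ∀ a b → a + (b - a) ≡ b
    lemma = solve-∀

  Bridge-+n : ∀ {x} → Bridge x → Bridge (x + + n)
  Bridge-+n {x} b = subst (λ v → Joined T (upper (superscript v)) v) (sym (vtx-+n x)) (joined-shift (+ 1) b)

  Bridge-−n : ∀ {x} → Bridge (x + + n) → Bridge x
  Bridge-−n {x} b = subst (λ k → Joined T (upper k) (lower (idx x) k)) (lemma (sup x))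
    (joined-shift (ℤ.- + 1) (subst (λ v → Joined T (upper (superscript v)) v) (vtx-+n x) b))
    where
    lemma : ∀ a → a + + 1 + ℤ.- + 1 ≡ a
    lemma = solve-∀

  First : ℤ → ℤ → Set
  First x y = x ℤ.≤ y × Bridge y × (∀ z → x ℤ.≤ z → z ℤ.< y → ¬ Bridge z)

  record Consecutive (x y : ℤ) : Set where
    constructor consecutive
    field
      x<y  : x ℤ.< y
      bx   : Bridge x
      by   : Bridge y
      none : ∀ z → x ℤ.< z → z ℤ.< y → ¬ Bridge z

  abstract
    next-bridge : ∀ x → ∃[ y ] First x y
    next-bridge x with first-from Bridge? (Bridge₀ (sucℤ (sup x)))
      (subst (ℤ._≤ pos i₀ (sucℤ (sup x))) (pos-vtx x)
        (ℤₚ.<⇒≤ (<∂⇒pos< {idx x} {i₀} {sup x} {sucℤ (sup x)} (lower-block (i<suc[i] (sup x))))))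
    ... | y , x≤y , _ , b , none = y , x≤y , b , none

    next-consecutive : ∀ {x} → Bridge x → ∃[ y ] Consecutive x y
    next-consecutive {x} bx with next-bridge (sucℤ x)
    ... | y , sx≤y , by , none =
      y , consecutive (ℤₚ.suc[i]≤j⇒i<j sx≤y) bx by (λ z x<z → none z (ℤₚ.i<j⇒suc[i]≤j x<z))

    previous-bridge : ∀ y → ∃[ x ] x ℤ.< y × Bridge x × (∀ z → x ℤ.< z → z ℤ.< y → ¬ Bridge z)
    previous-bridge y with last-below Bridge? (Bridge₀ (pred (sup y)))
      (subst (pos i₀ (pred (sup y)) ℤ.<_) (pos-vtx y)
        (<∂⇒pos< {i₀} {idx y} {pred (sup y)} {sup y} (lower-block (ℤₚ.i≤pred[j]⇒i<j ℤₚ.≤-refl))))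
    ... | x , _ , x<y , b , none = x , x<y , b , none

    previous-consecutive : ∀ {y} → Bridge y → ∃[ x ] Consecutive x y
    previous-consecutive {y} by with previous-bridge y
    ... | x , x<y , bx , none = x , consecutive x<y bx by none

    -- A lower arc crossing x y would cross the bridging arc at x or at y, and no bridging arc ends
    -- in between, so `add-arc` applies.
    consecutive-Edge : ∀ {x y} → Consecutive x y → Edge x y
    consecutive-Edge {x} {y} (consecutive x<y bx by none) with y ℤₚ.≟ sucℤ x
    ... | yes y≡sx = inj₁ y≡sx
    ... | no  y≢sx = inj₂ (add-arc x<y y≢sx
      (λ ac a<x x<c _ → Arc-Bridge ac bx a<x x<c)
      (λ ac _ a<y y<c → Arc-Bridge ac by a<y y<c)
      (λ bz x<z z<y → none _ x<z z<y bz))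

    consecutive-Tree : ∀ {x y} → Consecutive x y → Tree x y
    consecutive-Tree c = Edge⇒Tree (Consecutive.x<y c) (consecutive-Edge c)

    -- The nearest bridging vertices on both sides of y are consecutive, hence the ends of an edge,
    -- and y lies inside its tree.
    ¬Bridge⇒Middle : ∀ {y} → ¬ Bridge y → Middle y
    ¬Bridge⇒Middle {y} ¬by with previous-bridge y | next-bridge y
    ... | x , x<y , bx , none | z , y≤z , bz , none′ with ≤⇒<⊎≡ y≤z
    ...   | inj₂ refl = contradiction bz ¬by
    ...   | inj₁ y<z  = find-middle (consecutive-Tree (consecutive (ℤₚ.<-trans x<y y<z) bx bz inside)) x<y y<z
      where
      inside : ∀ w → x ℤ.< w → w ℤ.< z → ¬ Bridge w
      inside w x<w w<z with ℤₚ.<-cmp w y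
      ... | tri< w<y _ _  = none w x<w w<y
      ... | tri≈ _ refl _ = ¬by
      ... | tri> _ _ y<w  = none′ w (ℤₚ.<⇒≤ y<w) w<z

  Consecutive-+n : ∀ {x y} → Consecutive x y → Consecutive (x + + n) (y + + n)
  Consecutive-+n {x} {y} (consecutive x<y bx by none) =
    consecutive (ℤₚ.+-monoˡ-< (+ n) x<y) (Bridge-+n bx) (Bridge-+n by) λ z x+n<z z<y+n bz →
      none (z - + n)
        (subst (ℤ._< z - + n) (cancel x (+ n)) (ℤₚ.+-monoˡ-< (ℤ.- + n) x+n<z))
        (subst (z - + n ℤ.<_) (cancel y (+ n)) (ℤₚ.+-monoˡ-< (ℤ.- + n) z<y+n))
        (Bridge-−n (subst Bridge (sym (cancel′ z (+ n))) bz))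
    where
    cancel : ∀ a b → a + b - b ≡ a
    cancel = solve-∀
    cancel′ : ∀ a b → a - b + b ≡ a
    cancel′ = solve-∀

  First-unique : ∀ {x y z} → First x y → First x z → y ≡ z
  First-unique {y = y} {z} (x≤y , by , none) (x≤z , bz , none′) with ℤₚ.<-cmp y z
  ... | tri< y<z _ _ = contradiction by (none′ y x≤y y<z)
  ... | tri≈ _ y≡z _ = y≡z
  ... | tri> _ _ z<y = contradiction bz (none z x≤z z<y)

  First-pred : ∀ {x y} → ¬ Bridge x → First (sucℤ x) y → First x y
  First-pred {x} ¬bx (sx≤y , by , none) =
    ℤₚ.≤-trans (ℤₚ.i≤suc[i] x) sx≤y , by , λ z x≤z z<y → below z (≤⇒<⊎≡ x≤z) z<y
    where
    below : ∀ z → x ℤ.< z ⊎ x ≡ z → z ℤ.< _ → ¬ Bridge z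
    below z (inj₁ x<z)  = none z (ℤₚ.i<j⇒suc[i]≤j x<z)
    below z (inj₂ refl) _ = ¬bx

  First-self : ∀ {x} → Bridge x → First x x
  First-self bx = ℤₚ.≤-refl , bx , λ z x≤z z<x _ → ℤₚ.<-irrefl refl (ℤₚ.≤-<-trans x≤z z<x)

  First-consecutive : ∀ {x y} → Bridge x → First (sucℤ x) y → Consecutive x y
  First-consecutive bx (sx≤y , by , none) =
    consecutive (ℤₚ.suc[i]≤j⇒i<j sx≤y) bx by λ z x<z → none z (ℤₚ.i<j⇒suc[i]≤j x<z)

  First-+n : ∀ {x y} → First x y → First (x + + n) (y + + n)
  First-+n {x} {y} (x≤y , by , none) =
    ℤₚ.+-monoˡ-≤ (+ n) x≤y , Bridge-+n by , λ z x+n≤z z<y+n bz →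
      none (z - + n)
        (subst (ℤ._≤ z - + n) (cancel x (+ n)) (ℤₚ.+-monoˡ-≤ (ℤ.- + n) x+n≤z))
        (subst (z - + n ℤ.<_) (cancel y (+ n)) (ℤₚ.+-monoˡ-< (ℤ.- + n) z<y+n))
        (Bridge-−n (subst Bridge (sym (cancel′ z (+ n))) bz))
    where
    cancel : ∀ a b → a + b - b ≡ a
    cancel = solve-∀
    cancel′ : ∀ a b → a - b + b ≡ a
    cancel′ = solve-∀

  -- Classification of the regions

  -- The region between two consecutive bridging arcs.
  data Cap (x y : ℤ) : List (Vertex n) → Set where
    cap₃ : Bridge x → Bridge y → x ℤ.< y → Edge x y → sup y ≡ sup x →
           Cap x y (vtx x ∷ vtx y ∷ upper (sup x) ∷ [])
    cap₄ : Bridge x → Bridge y → x ℤ.< y → Edge x y → sup y ≡ sup x + + 1 →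
           Cap x y (vtx x ∷ vtx y ∷ upper (sup y) ∷ upper (sup x) ∷ [])

  -- `IsTriangle` sorted by the number of lower corners, three or two, in integer coordinates; the
  -- counting and labelling proofs match on this form.
  data Region : List (Vertex n) → Set where
    tri : ∀ {x y z} → Tri x y z → Region (vtx x ∷ vtx y ∷ vtx z ∷ [])
    cap : ∀ {x y P} → Cap x y P → Region P

  Region⇒IsTriangle : ∀ {P} → Region P → IsTriangle T P
  Region⇒IsTriangle (tri (mkTri x<y y<z xy yz xz)) =
    three-sided (<⇒<∂ x<y) (<⇒<∂ y<z) (Edge⇒Side xy) (Edge⇒Side yz) (Edge⇒Side xz)
  Region⇒IsTriangle (cap {x} {y} (cap₃ bx by x<y xy eq)) =
    three-sided (<⇒<∂ x<y) lower-upper (Edge⇒Side xy)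
      (inj₁ (joined-sym T (subst (λ k → Joined T (upper k) (vtx y)) eq by)))
      (inj₁ (joined-sym T bx))
  Region⇒IsTriangle (cap (cap₄ bx by x<y xy eq)) = go eq bx by (Edge⇒Side xy)
    where
    go : ∀ {i i′ k k′} → k′ ≡ k + + 1 → Joined T (upper k) (lower i k) →
         Joined T (upper k′) (lower i′ k′) → Side T (lower i k) (lower i′ k′) →
         IsTriangle T (lower i k ∷ lower i′ k′ ∷ upper k′ ∷ upper k ∷ [])
    go refl = four-sided

  Side-bridge : ∀ {k i l} → Side T (lower i l) (upper k) → Joined T (upper k) (lower i l)
  Side-bridge (inj₁ j)         = joined-sym T j
  Side-bridge (inj₂ (inj₁ ()))
  Side-bridge (inj₂ (inj₂ ()))

  IsTriangle⇒Region : ∀ {P} → IsTriangle T P → Region P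
  IsTriangle⇒Region (three-sided {lower i k} {lower j l} {lower h m} u<v v<w uv vw uw)
    with lower-view i k | lower-view j l | lower-view h m
  ... | at x | at y | at z =
    tri (mkTri x<y y<z (Side⇒Edge x<y uv) (Side⇒Edge y<z vw) (Side⇒Edge (ℤₚ.<-trans x<y y<z) uw))
    where
    x<y = <∂⇒< u<v
    y<z = <∂⇒< v<w
  IsTriangle⇒Region (three-sided {lower i k} {lower j l} {upper m} u<v v<w uv vw uw)
    with lower-view i k | lower-view j l
  ... | at x | at y with bridge-sup (Side-bridge vw) | bridge-sup (Side-bridge uw)
  ...   | m≡y | refl =
    cap (cap₃ (Side-bridge uw) (to-Bridge (Side-bridge vw)) (<∂⇒< u<v) (Side⇒Edge (<∂⇒< u<v) uv) (sym m≡y))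
  -- Both sides at the lower vertex are bridging, so A3 gives the two upper ends the same
  -- superscript.
  IsTriangle⇒Region (three-sided {lower i k} {upper l} {upper m} u<v (upper-upper m<l) uv vw uw) =
    ⊥-elim (ℤₚ.<-irrefl (trans (bridge-sup (Side-bridge uw)) (sym (bridge-sup (Side-bridge uv)))) m<l)
  -- No arc joins two upper vertices, and neighbouring upper vertices have no third one between
  -- them.
  IsTriangle⇒Region (three-sided {upper k} {upper l} {upper m} (upper-upper l<k) (upper-upper m<l) _ _ uw) =
    ⊥-elim (no-side uw)
    where
    no-side : ¬ Side T (upper k) (upper m)
    no-side (inj₁ j) with IsArc.A1 (joined-arc T j)
    ... | inj₁ ()
    ... | inj₂ ()
    no-side (inj₂ (inj₁ upper-next)) =
      ℤₚ.<-asym (ℤₚ.<-trans m<l l<k) (subst (k ℤ.<_) (ℤₚ.+-comm (+ 1) k) (i<suc[i] k))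
    no-side (inj₂ (inj₂ upper-next)) = none-between m<l (subst (l ℤ.<_) (ℤₚ.+-comm m (+ 1)) l<k)
  IsTriangle⇒Region (four-sided bx by xy) = go refl bx by xy
    where
    -- The superscript k + 1 becomes a variable `k′`, so that the view can unify it with `sup y`.
    go : ∀ {i i′ k k′} → k′ ≡ k + + 1 → Joined T (upper k) (lower i k) →
         Joined T (upper k′) (lower i′ k′) → Side T (lower i k) (lower i′ k′) →
         Region (lower i k ∷ lower i′ k′ ∷ upper k′ ∷ upper k ∷ [])
    go {i} {i′} {k} {k′} eq bx by xy with lower-view i k | lower-view i′ k′
    ... | at x | at y = cap (cap₄ bx by x<y (Side⇒Edge x<y xy) eq)
      where
      x<y : x ℤ.< y
      x<y = <∂⇒< (lower-block (subst (sup x ℤ.<_) (trans (ℤₚ.+-comm (+ 1) (sup x)) (sym eq)) (i<suc[i] (sup x))))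

  abstract
    -- Since x + n is bridging again, y lies at most n to the right of x, and its superscript is
    -- that of x or the next one: the two shapes of a cap.
    consecutive-Cap : ∀ {x y} → Consecutive x y → ∃[ P ] Cap x y P
    consecutive-Cap {x} {y} c@(consecutive x<y bx by none) with ≤⇒<⊎≡ (sup-mono (ℤₚ.<⇒≤ x<y))
    ... | inj₂ eq = _ , cap₃ bx by x<y (consecutive-Edge c) (sym eq)
    ... | inj₁ lt = _ , cap₄ bx by x<y (consecutive-Edge c) (ℤₚ.≤-antisym sy≤ sx+1≤)
      where
      y≤x+n : y ℤ.≤ x + + n
      y≤x+n = ℤₚ.≮⇒≥ λ x+n<y → none (x + + n)
        (subst (ℤ._< x + + n) (ℤₚ.+-identityʳ x) (ℤₚ.+-monoʳ-< x (ℤ.+<+ (ℕ.>-nonZero⁻¹ n)))) x+n<y (Bridge-+n bx)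
      sy≤ : sup y ℤ.≤ sup x + + 1
      sy≤ = subst (sup y ℤ.≤_) (cong superscript (vtx-+n x)) (sup-mono y≤x+n)
      sx+1≤ : sup x + + 1 ℤ.≤ sup y
      sx+1≤ = subst (ℤ._≤ sup y) (ℤₚ.+-comm (+ 1) (sup x)) (ℤₚ.i<j⇒suc[i]≤j lt)

  Cap-unique : ∀ {x y P Q} → Cap x y P → Cap x y Q → P ≡ Q
  Cap-unique (cap₃ _ _ _ _ _) (cap₃ _ _ _ _ _)  = refl
  Cap-unique {x} (cap₃ _ _ _ _ p) (cap₄ _ _ _ _ q)  =
    contradiction (trans (trans (sym p) q) (ℤₚ.+-comm (sup x) (+ 1))) ℤₚ.i≢suc[i]
  Cap-unique {x} (cap₄ _ _ _ _ p) (cap₃ _ _ _ _ q)  =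
    contradiction (trans (trans (sym q) p) (ℤₚ.+-comm (sup x) (+ 1))) ℤₚ.i≢suc[i]
  Cap-unique (cap₄ _ _ _ _ _) (cap₄ _ _ _ _ _)  = refl

  -- Counting the triangles at a lower vertex

  ⟨_,_,_⟩ : ℤ → ℤ → ℤ → List (Vertex n)
  ⟨ x , y , z ⟩ = vtx x ∷ vtx y ∷ vtx z ∷ []

  -- The left spine of the tree; its nodes are the triangles under the edge that have x as a corner.
  -- `rightFan` is the mirror image.
  leftFan : ∀ {x z} → Tree x z → List (List (Vertex n))
  leftFan (leaf x)                       = []
  leftFan {x} {z} (node {y = y} _ l _)   = ⟨ x , y , z ⟩ ∷ leftFan l

  rightFan : ∀ {x z} → Tree x z → List (List (Vertex n))
  rightFan (leaf x)                      = []
  rightFan {x} {z} (node {y = y} _ _ r)  = ⟨ x , y , z ⟩ ∷ rightFan r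

  ∈-leftFan⁻ : ∀ {x z P} (t : Tree x z) → P ∈ leftFan t →
    ∃[ y ] ∃[ w ] P ≡ ⟨ x , y , w ⟩ × Tri x y w × w ℤ.≤ z
  ∈-leftFan⁻ (node j l r) (here refl) = _ , _ , refl , node-Tri j l r , ℤₚ.≤-refl
  ∈-leftFan⁻ (node j l r) (there p) with ∈-leftFan⁻ l p
  ... | y , w , eq , t , w≤ = y , w , eq , t , ℤₚ.≤-trans w≤ (ℤₚ.<⇒≤ (tree-< r))

  ∈-rightFan⁻ : ∀ {x z P} (t : Tree x z) → P ∈ rightFan t →
    ∃[ y ] ∃[ w ] P ≡ ⟨ w , y , z ⟩ × Tri w y z × x ℤ.≤ w
  ∈-rightFan⁻ (node j l r) (here refl) = _ , _ , refl , node-Tri j l r , ℤₚ.≤-refl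
  ∈-rightFan⁻ (node j l r) (there p) with ∈-rightFan⁻ r p
  ... | y , w , eq , t , ≤w = y , w , eq , t , ℤₚ.≤-trans (ℤₚ.<⇒≤ (tree-< l)) ≤w

  ⟨⟩-injective : ∀ {x y z x′ y′ z′} → ⟨ x , y , z ⟩ ≡ ⟨ x′ , y′ , z′ ⟩ → x ≡ x′ × y ≡ y′ × z ≡ z′
  ⟨⟩-injective eq with ∷-inj eq
    where
    ∷-inj : ∀ {a b c a′ b′ c′ : Vertex n} → a ∷ b ∷ c ∷ [] ≡ a′ ∷ b′ ∷ c′ ∷ [] → a ≡ a′ × b ≡ b′ × c ≡ c′
    ∷-inj refl = refl , refl , refl
  ... | p , q , r = vtx-injective p , vtx-injective q , vtx-injective r

  leftFan-! : ∀ {x z} (t : Tree x z) → Unique (leftFan t)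
  leftFan-! (leaf x)               = []
  leftFan-! {x} {z} (node {y = y} j l r) = All.tabulate fresh ∷ leftFan-! l
    where
    fresh : ∀ {P} → P ∈ leftFan l → ⟨ x , y , z ⟩ ≢ P
    fresh p eq with ∈-leftFan⁻ l p
    ... | _ , w , refl , _ , w≤y with ⟨⟩-injective eq
    ...   | _ , _ , refl = ℤₚ.≤⇒≯ w≤y (tree-< r)

  rightFan-! : ∀ {x z} (t : Tree x z) → Unique (rightFan t)
  rightFan-! (leaf x)               = []
  rightFan-! {x} {z} (node {y = y} j l r) = All.tabulate fresh ∷ rightFan-! r
    where
    fresh : ∀ {P} → P ∈ rightFan r → ⟨ x , y , z ⟩ ≢ P
    fresh p eq with ∈-rightFan⁻ r p
    ... | _ , w , refl , _ , y≤w with ⟨⟩-injective eq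
    ...   | refl , _ , _ = ℤₚ.≤⇒≯ y≤w (tree-< l)

  -- Of two different apexes, the edge from x to the right one would cross the edge from the left
  -- one to z.
  apex-unique : ∀ {x y y′ z} → Tri x y z → Tri x y′ z → y ≡ y′
  apex-unique {y = y} {y′} t t′ with ℤₚ.<-cmp y y′
  ... | tri< y<y′ _ _ = ⊥-elim (Edge-cross (Tri.xy t′) (Tri.yz t) (Tri.x<y t) y<y′ (Tri.y<z t′))
  ... | tri≈ _ y≡y′ _ = y≡y′
  ... | tri> _ _ y′<y = ⊥-elim (Edge-cross (Tri.xy t) (Tri.yz t′) (Tri.x<y t′) y′<y (Tri.y<z t))

  -- If the bases differ at one end, a side of one triangle at y crosses the base of the other.
  base-unique : ∀ {x x′ y z z′} → Tri x y z → Tri x′ y z′ → x ≡ x′ × z ≡ z′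
  base-unique t t′ = left , right
    where
    module t = Tri t
    module t′ = Tri t′
    left : _ ≡ _
    left with ℤₚ.<-cmp _ _
    ... | tri< x<x′ _ _ = ⊥-elim (Edge-cross t.xy t′.xz x<x′ t′.x<y t′.y<z)
    ... | tri≈ _ x≡x′ _ = x≡x′
    ... | tri> _ _ x′<x = ⊥-elim (Edge-cross t′.xy t.xz x′<x t.x<y t.y<z)
    right : _ ≡ _
    right with ℤₚ.<-cmp _ _
    ... | tri< z<z′ _ _ = ⊥-elim (Edge-cross t.xz t′.yz t.x<y t.y<z z<z′)
    ... | tri≈ _ z≡z′ _ = z≡z′
    ... | tri> _ _ z′<z = ⊥-elim (Edge-cross t′.xz t.yz t′.x<y t′.y<z z′<z)

  -- For w = z, uniqueness of the apex gives the top node. For w < z, the edge x w would cross v z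
  -- if v < w, so w ≤ v and the triangle lies in the left subtree.
  ∈-leftFan⁺ : ∀ {x y w z} (t : Tree x z) → Tri x y w → w ℤ.≤ z → ⟨ x , y , w ⟩ ∈ leftFan t
  ∈-leftFan⁺ (leaf x) s w≤z = ⊥-elim (none-between (Tri.x<y s) (ℤₚ.<-≤-trans (Tri.y<z s) w≤z))
  ∈-leftFan⁺ {y = y} {w} {z} (node {y = v} j l r) s w≤z with ≤⇒<⊎≡ w≤z
  ... | inj₂ refl with apex-unique s (node-Tri j l r)
  ...   | refl = here refl
  ∈-leftFan⁺ {y = y} {w} {z} (node {y = v} j l r) s w≤z | inj₁ w<z with ℤₚ.<-cmp v w
  ... | tri< v<w _ _  = ⊥-elim (Edge-cross (Tri.xz s) (tree-Edge r) (tree-< l) v<w w<z)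
  ... | tri≈ _ refl _ = there (∈-leftFan⁺ l s ℤₚ.≤-refl)
  ... | tri> _ _ w<v  = there (∈-leftFan⁺ l s (ℤₚ.<⇒≤ w<v))

  ∈-rightFan⁺ : ∀ {x y w z} (t : Tree x z) → Tri w y z → x ℤ.≤ w → ⟨ w , y , z ⟩ ∈ rightFan t
  ∈-rightFan⁺ (leaf x) s x≤w = ⊥-elim (none-between (ℤₚ.≤-<-trans x≤w (Tri.x<y s)) (Tri.y<z s))
  ∈-rightFan⁺ {y = y} {w} {z} (node {y = v} j l r) s x≤w with ≤⇒<⊎≡ x≤w
  ... | inj₂ refl with apex-unique s (node-Tri j l r)
  ...   | refl = here refl
  ∈-rightFan⁺ {y = y} {w} {z} (node {y = v} j l r) s x≤w | inj₁ x<w with ℤₚ.<-cmp w v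
  ... | tri< w<v _ _  = ⊥-elim (Edge-cross (tree-Edge l) (Tri.xz s) x<w w<v (tree-< r))
  ... | tri≈ _ refl _ = there (∈-rightFan⁺ r s ℤₚ.≤-refl)
  ... | tri> _ _ v<w  = there (∈-rightFan⁺ r s (ℤₚ.<⇒≤ v<w))

  fans : ∀ {x y z} → Tree x y → Tree y z → List (List (Vertex n))
  fans l r = rightFan l ++ leftFan r

  data InFans (y : ℤ) : List (Vertex n) → Set where
    left  : ∀ {a b} → Tri a b y → InFans y ⟨ a , b , y ⟩
    right : ∀ {b c} → Tri y b c → InFans y ⟨ y , b , c ⟩

  ∈-fans⁻ : ∀ {x y z P} (l : Tree x y) (r : Tree y z) → P ∈ fans l r → InFans y P
  ∈-fans⁻ l r p with ∈-++⁻ (rightFan l) p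
  ... | inj₁ q with ∈-rightFan⁻ l q
  ...   | _ , _ , refl , t , _ = left t
  ∈-fans⁻ l r p | inj₂ q with ∈-leftFan⁻ r q
  ...   | _ , _ , refl , t , _ = right t

  fans-! : ∀ {x y z} (l : Tree x y) (r : Tree y z) → Unique (fans l r)
  fans-! l r = Uniqueₚ.++⁺ (rightFan-! l) (leftFan-! r) λ (p , q) → disjoint p q
    where
    disjoint : ∀ {P} → P ∈ rightFan l → ¬ P ∈ leftFan r
    disjoint p q with ∈-rightFan⁻ l p | ∈-leftFan⁻ r q
    ... | _ , w , refl , t , _ | _ , _ , eq , _ with ⟨⟩-injective eq
    ...   | refl , _ = ℤₚ.<-asym (Tri.x<y t) (Tri.y<z t)

  InFans-∋ : ∀ {y P} → InFans y P → Region P × vtx y ∈ P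
  InFans-∋ (left t)  = tri t , there (there (here refl))
  InFans-∋ (right t) = tri t , here refl

  Cap-∈⁻ : ∀ {x y P u} → Cap x y P → u ∈ P → u ≡ vtx x ⊎ u ≡ vtx y ⊎ IsUpper u
  Cap-∈⁻ (cap₃ _ _ _ _ _) (here eq)                            = inj₁ eq
  Cap-∈⁻ (cap₄ _ _ _ _ _) (here eq)                            = inj₁ eq
  Cap-∈⁻ (cap₃ _ _ _ _ _) (there (here eq))                    = inj₂ (inj₁ eq)
  Cap-∈⁻ (cap₄ _ _ _ _ _) (there (here eq))                    = inj₂ (inj₁ eq)
  Cap-∈⁻ (cap₃ _ _ _ _ _) (there (there (here refl)))          = inj₂ (inj₂ (upper _))
  Cap-∈⁻ (cap₄ _ _ _ _ _) (there (there (here refl)))          = inj₂ (inj₂ (upper _))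
  Cap-∈⁻ (cap₄ _ _ _ _ _) (there (there (there (here refl))))  = inj₂ (inj₂ (upper _))

  Cap-∋ˡ : ∀ {x y P} → Cap x y P → vtx x ∈ P
  Cap-∋ˡ (cap₃ _ _ _ _ _) = here refl
  Cap-∋ˡ (cap₄ _ _ _ _ _) = here refl

  Cap-∋ʳ : ∀ {x y P} → Cap x y P → vtx y ∈ P
  Cap-∋ʳ (cap₃ _ _ _ _ _) = there (here refl)
  Cap-∋ʳ (cap₄ _ _ _ _ _) = there (here refl)

  Cap-head : ∀ {x y P} → Cap x y P → head P ≡ just (vtx x)
  Cap-head (cap₃ _ _ _ _ _) = refl
  Cap-head (cap₄ _ _ _ _ _) = refl

  Cap⇒Consecutive : ∀ {x y P} → Cap x y P → Consecutive x y
  Cap⇒Consecutive (cap₃ bx by x<y xy _) = consecutive x<y bx by λ z x<z z<y bz → Edge-Bridge xy bz x<z z<y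
  Cap⇒Consecutive (cap₄ bx by x<y xy _) = consecutive x<y bx by λ z x<z z<y bz → Edge-Bridge xy bz x<z z<y

  consecutive-uniqueʳ : ∀ {x y z} → Consecutive x y → Consecutive x z → y ≡ z
  consecutive-uniqueʳ {y = y} {z} (consecutive x<y _ by none) (consecutive x<z _ bz none′) with ℤₚ.<-cmp y z
  ... | tri< y<z _ _ = contradiction by (none′ y x<y y<z)
  ... | tri≈ _ y≡z _ = y≡z
  ... | tri> _ _ z<y = contradiction bz (none z x<z z<y)

  consecutive-uniqueˡ : ∀ {x y z} → Consecutive x z → Consecutive y z → x ≡ y
  consecutive-uniqueˡ {x} {y} (consecutive x<z bx _ none) (consecutive y<z by _ none′) with ℤₚ.<-cmp x y
  ... | tri< x<y _ _ = contradiction by (none y x<y y<z)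
  ... | tri≈ _ x≡y _ = x≡y
  ... | tri> _ _ y<x = contradiction bx (none′ x y<x x<z)

  -- The triangle with apex y, and the fans under its two sides. A triangle at y reaching beyond x
  -- or z would cross the arc x z, and that arc separates y from all caps.
  count-middle : ∀ {x y z} → Arc x z → (l : Tree x y) (r : Tree y z) →
    HasCardinality (λ P → IsTriangle T P × vtx y ∈ P) (suc (length (rightFan l) ℕ.+ length (leftFan r)))
  count-middle {x} {y} {z} xz l r =
    ⟨ x , y , z ⟩ ∷ fans l r , All.tabulate fresh ∷ fans-! l r
    , (λ P → mk⇔ sound λ (p , y∈P) → complete (IsTriangle⇒Region p) y∈P)
    , cong suc (length-++ (rightFan l))
    where
    fresh : ∀ {P} → P ∈ fans l r → ⟨ x , y , z ⟩ ≢ P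
    fresh p eq with ∈-fans⁻ l r p
    ... | left t with ⟨⟩-injective eq
    ...   | _ , _ , refl = ℤₚ.<-irrefl refl (tree-< r)
    fresh p eq | right t with ⟨⟩-injective eq
    ...   | refl , _ = ℤₚ.<-irrefl refl (tree-< l)

    sound : ∀ {P} → P ∈ ⟨ x , y , z ⟩ ∷ fans l r → IsTriangle T P × vtx y ∈ P
    sound (here refl) = Region⇒IsTriangle (tri (node-Tri xz l r)) , there (here refl)
    sound (there p) with InFans-∋ (∈-fans⁻ l r p)
    ... | q , y∈P = Region⇒IsTriangle q , y∈P

    ¬by : ¬ Bridge y
    ¬by by = Arc-Bridge xz by (tree-< l) (tree-< r)

    tri-case : ∀ {a b c} → Tri a b c → y ≡ a ⊎ y ≡ b ⊎ y ≡ c → ⟨ a , b , c ⟩ ∈ ⟨ x , y , z ⟩ ∷ fans l r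
    tri-case t (inj₁ refl) = there (∈-++⁺ʳ (rightFan l) (∈-leftFan⁺ r t
      (ℤₚ.≮⇒≥ λ z<c → Arc-cross xz (Edge⇒Arc (Tri.xz t) (Tri.x<y t) (Tri.y<z t)) (tree-< l) (tree-< r) z<c)))
    tri-case t (inj₂ (inj₁ refl)) with base-unique t (node-Tri xz l r)
    ... | refl , refl = here refl
    tri-case t (inj₂ (inj₂ refl)) = there (∈-++⁺ˡ (∈-rightFan⁺ l t
      (ℤₚ.≮⇒≥ λ a<x → Arc-cross (Edge⇒Arc (Tri.xz t) (Tri.x<y t) (Tri.y<z t)) xz a<x (tree-< l) (tree-< r))))

    complete : ∀ {P} → Region P → vtx y ∈ P → P ∈ ⟨ x , y , z ⟩ ∷ fans l r
    complete (tri t) (here eq)                 = tri-case t (inj₁ (vtx-injective eq))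
    complete (tri t) (there (here eq))         = tri-case t (inj₂ (inj₁ (vtx-injective eq)))
    complete (tri t) (there (there (here eq))) = tri-case t (inj₂ (inj₂ (vtx-injective eq)))
    complete (cap c) y∈P with Cap-∈⁻ c y∈P
    ... | inj₁ eq        = ⊥-elim (¬by (subst Bridge (sym (vtx-injective eq)) (Consecutive.bx (Cap⇒Consecutive c))))
    ... | inj₂ (inj₁ eq) = ⊥-elim (¬by (subst Bridge (sym (vtx-injective eq)) (Consecutive.by (Cap⇒Consecutive c))))
    ... | inj₂ (inj₂ ())

  -- The bridging arc forbids a triangle with middle corner y; the caps on its two sides come
  -- instead, whence 2 in place of 1. A triangle reaching beyond x or z would cross the bridging arc
  -- there.
  count-bridge : ∀ {x y z} (xy : Consecutive x y) (yz : Consecutive y z) →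
    HasCardinality (λ P → IsTriangle T P × vtx y ∈ P)
      (suc (suc (length (rightFan (consecutive-Tree xy)) ℕ.+ length (leftFan (consecutive-Tree yz)))))
  count-bridge {x} {y} {z} xy yz =
    Pxy ∷ Pyz ∷ fans l r
    , (All.tabulate fresh-xy ∷ All.tabulate fresh-yz ∷ fans-! l r)
    , (λ P → mk⇔ sound λ (p , y∈P) → complete (IsTriangle⇒Region p) y∈P)
    , cong (λ t → suc (suc t)) (length-++ (rightFan l))
    where
    l = consecutive-Tree xy
    r = consecutive-Tree yz
    Pxy = proj₁ (consecutive-Cap xy)
    Pyz = proj₁ (consecutive-Cap yz)
    cxy = proj₂ (consecutive-Cap xy)
    cyz = proj₂ (consecutive-Cap yz)
    by  = Consecutive.by xy

    Cap≢fan : ∀ {a b P} → Cap a b P → ¬ InFans y P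
    Cap≢fan (cap₃ _ _ _ _ _) ()
    Cap≢fan (cap₄ _ _ _ _ _) ()

    fresh-xy : ∀ {P} → P ∈ Pyz ∷ fans l r → Pxy ≢ P
    fresh-xy (here refl) eq = ℤₚ.<-irrefl
      (vtx-injective (just-injective (trans (sym (Cap-head cxy)) (trans (cong head eq) (Cap-head cyz)))))
      (Consecutive.x<y xy)
    fresh-xy (there p) refl = Cap≢fan cxy (∈-fans⁻ l r p)

    fresh-yz : ∀ {P} → P ∈ fans l r → Pyz ≢ P
    fresh-yz p refl = Cap≢fan cyz (∈-fans⁻ l r p)

    sound : ∀ {P} → P ∈ Pxy ∷ Pyz ∷ fans l r → IsTriangle T P × vtx y ∈ P
    sound (here refl)         = Region⇒IsTriangle (cap cxy) , Cap-∋ʳ cxy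
    sound (there (here refl)) = Region⇒IsTriangle (cap cyz) , Cap-∋ˡ cyz
    sound (there (there p)) with InFans-∋ (∈-fans⁻ l r p)
    ... | q , y∈P = Region⇒IsTriangle q , y∈P

    tri-case : ∀ {a b c} → Tri a b c → y ≡ a ⊎ y ≡ b ⊎ y ≡ c → ⟨ a , b , c ⟩ ∈ Pxy ∷ Pyz ∷ fans l r
    tri-case t (inj₁ refl) = there (there (∈-++⁺ʳ (rightFan l) (∈-leftFan⁺ r t
      (ℤₚ.≮⇒≥ λ z<c → Edge-Bridge (Tri.xz t) (Consecutive.by yz) (Consecutive.x<y yz) z<c))))
    tri-case t (inj₂ (inj₁ refl)) = ⊥-elim (Edge-Bridge (Tri.xz t) by (Tri.x<y t) (Tri.y<z t))
    tri-case t (inj₂ (inj₂ refl)) = there (there (∈-++⁺ˡ (∈-rightFan⁺ l t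
      (ℤₚ.≮⇒≥ λ a<x → Edge-Bridge (Tri.xz t) (Consecutive.bx xy) a<x (Consecutive.x<y xy)))))

    complete : ∀ {P} → Region P → vtx y ∈ P → P ∈ Pxy ∷ Pyz ∷ fans l r
    complete (tri t) (here eq)                 = tri-case t (inj₁ (vtx-injective eq))
    complete (tri t) (there (here eq))         = tri-case t (inj₂ (inj₁ (vtx-injective eq)))
    complete (tri t) (there (there (here eq))) = tri-case t (inj₂ (inj₂ (vtx-injective eq)))
    complete (cap c) y∈P with Cap-∈⁻ c y∈P
    ... | inj₂ (inj₂ ())
    ... | inj₁ eq with vtx-injective eq
    ...   | refl with consecutive-uniqueʳ (Cap⇒Consecutive c) yz
    ...     | refl = there (here (Cap-unique c cyz))
    complete (cap c) y∈P | inj₂ (inj₁ eq) with vtx-injective eq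
    ...   | refl with consecutive-uniqueˡ (Cap⇒Consecutive c) xy
    ...     | refl = here (Cap-unique c cxy)

  -- The labelling algorithm

  module _ (s : ℤ) where

    Labelled : ℕ → Vertex n → Set
    Labelled t w = ∃[ x ] LabelAfter T s t w x

    upper-label : ∀ t k → LabelAfter T s t (upper k) 0
    upper-label zero    k = upper-vertex
    upper-label (suc t) k = inj₁ (upper-label t k)

    upper-label-0 : ∀ t {k x} → LabelAfter T s t (upper k) x → x ≡ 0
    upper-label-0 zero    upper-vertex     = refl
    upper-label-0 (suc t) (inj₁ old)       = upper-label-0 t old
    upper-label-0 (suc t) (inj₂ (new , _)) = contradiction (upper-label t _) (new 0)

    ≡⇒≈ : ∀ {u v : Vertex n} → u ≡ v → u ≈ v
    ≡⇒≈ refl = same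

    module _ {x y z u v w} (c : Corners ⟨ x , y , z ⟩ u v w) where
      open Corners c

      -- With w at one end, the distinct corners u and v cannot both be the other end, so one of
      -- them is the middle. For Q = `Labelled t`: an end is labelled from such a triangle only if
      -- its middle already has a label.
      corners-left : w ≡ vtx x → ∀ {Q : Vertex n → Set} → Q u → Q v → Q (vtx y)
      corners-left w≡x {Q} qu qv = go u∈P v∈P
        where
        go : u ∈ ⟨ x , y , z ⟩ → v ∈ ⟨ x , y , z ⟩ → Q (vtx y)
        go (here u≡x) _                                       = ⊥-elim (u≉w (≡⇒≈ (trans u≡x (sym w≡x))))
        go (there (here u≡y)) _                               = subst Q u≡y qu
        go (there (there (here _))) (here v≡x)                = ⊥-elim (v≉w (≡⇒≈ (trans v≡x (sym w≡x))))
        go (there (there (here _))) (there (here v≡y))        = subst Q v≡y qv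
        go (there (there (here u≡z))) (there (there (here v≡z))) = ⊥-elim (u≉v (≡⇒≈ (trans u≡z (sym v≡z))))

      corners-right : w ≡ vtx z → ∀ {Q : Vertex n → Set} → Q u → Q v → Q (vtx y)
      corners-right w≡z {Q} qu qv = go u∈P v∈P
        where
        go : u ∈ ⟨ x , y , z ⟩ → v ∈ ⟨ x , y , z ⟩ → Q (vtx y)
        go (there (there (here u≡z))) _                       = ⊥-elim (u≉w (≡⇒≈ (trans u≡z (sym w≡z))))
        go (there (here u≡y)) _                               = subst Q u≡y qu
        go (here _) (there (there (here v≡z)))                = ⊥-elim (v≉w (≡⇒≈ (trans v≡z (sym w≡z))))
        go (here _) (there (here v≡y))                        = subst Q v≡y qv
        go (here u≡x) (here v≡x)                              = ⊥-elim (u≉v (≡⇒≈ (trans u≡x (sym v≡x))))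

      corners-middle : w ≡ vtx y → (u ≡ vtx x × v ≡ vtx z) ⊎ (u ≡ vtx z × v ≡ vtx x)
      corners-middle w≡y = go u∈P v∈P
        where
        go : u ∈ ⟨ x , y , z ⟩ → v ∈ ⟨ x , y , z ⟩ → (u ≡ vtx x × v ≡ vtx z) ⊎ (u ≡ vtx z × v ≡ vtx x)
        go (there (here u≡y)) _                               = ⊥-elim (u≉w (≡⇒≈ (trans u≡y (sym w≡y))))
        go _ (there (here v≡y))                               = ⊥-elim (v≉w (≡⇒≈ (trans v≡y (sym w≡y))))
        go (here u≡x) (here v≡x)                              = ⊥-elim (u≉v (≡⇒≈ (trans u≡x (sym v≡x))))
        go (here u≡x) (there (there (here v≡z)))              = inj₁ (u≡x , v≡z)
        go (there (there (here u≡z))) (here v≡x)              = inj₂ (u≡z , v≡x)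
        go (there (there (here u≡z))) (there (there (here v≡z))) = ⊥-elim (u≉v (≡⇒≈ (trans u≡z (sym v≡z))))

    middle-¬Bridge : ∀ {x y z} → Tri x y z → ¬ Bridge y
    middle-¬Bridge t by = Edge-Bridge (Tri.xz t) by (Tri.x<y t) (Tri.y<z t)

    middle-initial : ∀ {x y z v} → Tri x y z → ¬ LabelAfter T s zero (vtx y) v
    middle-initial t (joined j) = middle-¬Bridge t (to-Bridge j)

    -- Labels spread away from the upper boundary: the middle vertex of a
    -- triangle on the lower boundary is labelled after the other two.
    mutual
      middle-label : ∀ t {x y z v} → Tri x y z → LabelAfter T s (suc t) (vtx y) v →
        ∃[ a ] ∃[ b ] LabelAfter T s t (vtx x) a × LabelAfter T s t (vtx z) b × v ≡ a ℕ.+ b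
      middle-label zero    xyz (inj₁ old) = ⊥-elim (middle-initial xyz old)
      middle-label (suc t) xyz (inj₁ old) with middle-label t xyz old
      ... | a , b , la , lb , eq = a , b , inj₁ la , inj₁ lb , eq
      middle-label t {y = y} xyz (inj₂ (new , P , u , v , a , b , p , c , lu , lv , eq))
        with IsTriangle⇒Region p
      ... | cap k with Cap-∈⁻ k (Corners.w∈P c)
      ...   | inj₁ y≡ = ⊥-elim (middle-¬Bridge xyz (subst Bridge (sym (vtx-injective y≡)) (Consecutive.bx (Cap⇒Consecutive k))))
      ...   | inj₂ (inj₁ y≡) = ⊥-elim (middle-¬Bridge xyz (subst Bridge (sym (vtx-injective y≡)) (Consecutive.by (Cap⇒Consecutive k))))
      ...   | inj₂ (inj₂ ())
      middle-label t {y = y} xyz (inj₂ (new , P , u , v , a , b , p , c , lu , lv , eq)) | tri k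
        with Corners.w∈P c
      ... | here y≡ = ⊥-elim (new-end t k (corners-left c y≡ {Labelled t} (a , lu) (b , lv)) (inj₁ y≡) new)
      ... | there (there (here y≡)) =
        ⊥-elim (new-end t k (corners-right c y≡ {Labelled t} (a , lu) (b , lv)) (inj₂ y≡) new)
      ... | there (here y≡) with vtx-injective y≡
      ...   | refl with base-unique k xyz | corners-middle c y≡
      ...     | refl , refl | inj₁ (refl , refl) = a , b , lu , lv , eq
      ...     | refl , refl | inj₂ (refl , refl) = b , a , lv , lu , trans eq (ℕₚ.+-comm a b)

      -- A labelled middle leaves no unlabelled end, since `middle-label` finds both ends labelled
      -- one round earlier. The mutual recursion terminates because each passage through the two
      -- lemmas goes back one round.
      new-end : ∀ t {x y z w} → Tri x y z → Labelled t (vtx y) → w ≡ vtx x ⊎ w ≡ vtx z →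
        ¬ (∀ v → ¬ LabelAfter T s t w v)
      new-end zero    xyz (_ , ly) _ _ = middle-initial xyz ly
      new-end (suc t) xyz (_ , ly) w≡ new with middle-label t xyz ly
      new-end (suc t) xyz (_ , ly) (inj₁ refl) new | a , b , la , lb , _ = new a (inj₁ la)
      new-end (suc t) xyz (_ , ly) (inj₂ refl) new | a , b , la , lb , _ = new b (inj₁ lb)

    -- Corners not identified by `≈` are neither both upper nor both the bridging vertex, so the sum
    -- is 1 + 0 or 0 + 1.
    cap-label : ∀ t {o u v a b} → (∀ {c} → LabelAfter T s t (vtx o) c → c ≡ 1) →
      u ≡ vtx o ⊎ IsUpper u → v ≡ vtx o ⊎ IsUpper v → ¬ u ≈ v →
      LabelAfter T s t u a → LabelAfter T s t v b → a ℕ.+ b ≡ 1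
    cap-label t one (inj₁ refl)      (inj₁ refl)      u≉v lu lv = ⊥-elim (u≉v same)
    cap-label t one (inj₁ refl)      (inj₂ (upper _)) u≉v lu lv = cong₂ ℕ._+_ (one lu) (upper-label-0 t lv)
    cap-label t one (inj₂ (upper _)) (inj₁ refl)      u≉v lu lv = cong₂ ℕ._+_ (upper-label-0 t lu) (one lv)
    cap-label t one (inj₂ (upper _)) (inj₂ (upper _)) u≉v lu lv = ⊥-elim (u≉v both-upper)

    -- Only bridging vertices joined with the starting vertex get 1 at once. The others are labelled
    -- through caps, where the other bridging vertex has label 1 by induction on the round; a
    -- triangle with three lower corners never labels a bridging vertex.
    bridge-label : ∀ t {x v} → Bridge x → LabelAfter T s t (vtx x) v → v ≡ 1
    bridge-label zero    bx (joined _) = refl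
    bridge-label (suc t) bx (inj₁ old) = bridge-label t bx old
    bridge-label (suc t) {x} bx (inj₂ (new , P , u , v , a , b , p , c , lu , lv , eq))
      with IsTriangle⇒Region p
    ... | tri k with Corners.w∈P c
    ...   | here x≡ = ⊥-elim (new-end t k (corners-left c x≡ {Labelled t} (a , lu) (b , lv)) (inj₁ x≡) new)
    ...   | there (there (here x≡)) =
      ⊥-elim (new-end t k (corners-right c x≡ {Labelled t} (a , lu) (b , lv)) (inj₂ x≡) new)
    ...   | there (here x≡) = ⊥-elim (middle-¬Bridge k (subst Bridge (vtx-injective x≡) bx))
    bridge-label (suc t) {x} {w} bx (inj₂ (new , P , u , v , a , b , p , c , lu , lv , eq)) | cap {y} {z} k
      with Cap-∈⁻ k w∈P
      where open Corners c
    ... | inj₂ (inj₂ ())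
    ... | inj₁ x≡ = trans eq (cap-label t (bridge-label t (Consecutive.by (Cap⇒Consecutive k)))
                      (other u∈P u≉w) (other v∈P v≉w) u≉v lu lv)
      where
      open Corners c
      other : ∀ {e} → e ∈ P → ¬ e ≈ vtx x → e ≡ vtx z ⊎ IsUpper e
      other e∈P e≉x with Cap-∈⁻ k e∈P
      ... | inj₁ e≡y = ⊥-elim (e≉x (≡⇒≈ (trans e≡y (sym x≡))))
      ... | inj₂ r   = r
    ... | inj₂ (inj₁ x≡) = trans eq (cap-label t (bridge-label t (Consecutive.bx (Cap⇒Consecutive k)))
                             (other u∈P u≉w) (other v∈P v≉w) u≉v lu lv)
      where
      open Corners c
      other : ∀ {e} → e ∈ P → ¬ e ≈ vtx x → e ≡ vtx y ⊎ IsUpper e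
      other e∈P e≉x with Cap-∈⁻ k e∈P
      ... | inj₁ e≡y        = inj₁ e≡y
      ... | inj₂ (inj₁ e≡z) = ⊥-elim (e≉x (≡⇒≈ (trans e≡z (sym x≡))))
      ... | inj₂ (inj₂ r)   = inj₂ r

    -- `AreLabels` supplies each vertex with a round of its own, so labels from different rounds
    -- have to be compared. At a non-bridging vertex `middle-label` passes to two vertices in
    -- earlier rounds.
    label-unique : ∀ t t′ {x v v′} →
      LabelAfter T s t (vtx x) v → LabelAfter T s t′ (vtx x) v′ → v ≡ v′
    label-unique t t′ {x} lv lv′ with Bridge? x
    ... | yes bx = trans (bridge-label t bx lv) (sym (bridge-label t′ bx lv′))
    label-unique zero    _        lv lv′ | no ¬bx with ¬Bridge⇒Middle ¬bx
    ... | middle j l r = ⊥-elim (middle-initial (node-Tri j l r) lv)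
    label-unique (suc t) zero     lv lv′ | no ¬bx with ¬Bridge⇒Middle ¬bx
    ... | middle j l r = ⊥-elim (middle-initial (node-Tri j l r) lv′)
    label-unique (suc t) (suc t′) lv lv′ | no ¬bx with ¬Bridge⇒Middle ¬bx
    ... | middle j l r with middle-label t (node-Tri j l r) lv | middle-label t′ (node-Tri j l r) lv′
    ...   | _ , _ , la , lb , refl | _ , _ , la′ , lb′ , refl =
      cong₂ ℕ._+_ (label-unique t t′ la la′) (label-unique t t′ lb lb′)

    module _ (label : Fin n → ℕ) (labels : AreLabels T s label) where

      label-Bridge : ∀ {x} → Bridge x → label (idx x) ≡ 1
      label-Bridge {x} bx with labels (idx x) (sup x)
      ... | t , lx = bridge-label t bx lx

      label-Tri : ∀ {x y z} → Tri x y z → label (idx y) ≡ label (idx x) ℕ.+ label (idx z)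
      label-Tri {x} {y} {z} xyz with labels (idx x) (sup x) | labels (idx y) (sup y) | labels (idx z) (sup z)
      ... | _ | zero  , ly | _ = ⊥-elim (middle-initial xyz ly)
      ... | t , lx | suc t′ , ly | t″ , lz with middle-label t′ xyz ly
      ...   | a , b , la , lb , eq = trans eq (cong₂ ℕ._+_ (label-unique t′ t la lx) (label-unique t′ t″ lb lz))

  -- Solutions of the recurrence

  module _ (a : Fin n → ℕ) (quiddity : IsQuiddity T a) where

    A : ℤ → ℤ
    A x = + a (idx x)

    Solves : (ℤ → ℤ) → ℤ → Set
    Solves u x = u (sucℤ x) + u (pred x) ≡ A x * u x

    α β : ∀ {x z} → Tree x z → ℤ
    α t = + length (leftFan t)
    β t = + length (rightFan t)

    A-middle : ∀ {x y z} → Arc x z → (l : Tree x y) (r : Tree y z) → A y ≡ + 1 + (β l + α r)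
    A-middle {y = y} xz l r = cong +_ (cardinality-unique (quiddity (idx y) (sup y)) (count-middle xz l r))

    A-bridge : ∀ {x y z} (xy : Consecutive x y) (yz : Consecutive y z) →
      A y ≡ + 2 + (β (consecutive-Tree xy) + α (consecutive-Tree yz))
    A-bridge {y = y} xy yz = cong +_ (cardinality-unique (quiddity (idx y) (sup y)) (count-bridge xy yz))

    -- Down a spine, each triangle adds the value at the common corner to the value at the outer
    -- corner; the spine ends at the neighbour of the common corner.
    record Fan (u : ℤ → ℤ) {x z} (t : Tree x z) : Set where
      constructor fan
      field
        fromˡ : u (sucℤ x) ≡ α t * u x + u z
        fromʳ : u (pred z) ≡ β t * u z + u x

    module _ (u : ℤ → ℤ) (b : ℤ)
      (additive : ∀ {x y z} → b ℤ.≤ x → Arc x z → (l : Tree x y) (r : Tree y z) →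
                  Fan u l → Fan u r → u y ≡ u x + u z) where

      -- `additive` may use the fan identities of both halves: for labels it holds outright, whereas
      -- for a solution it is derived from them, in the same induction.
      additive⇒Fan : ∀ {x z} → b ℤ.≤ x → (t : Tree x z) → Fan u t
      additive⇒Fan b≤x (leaf x) =
        fan (lemma (u x) (u (sucℤ x))) (trans (cong u (ℤₚ.pred-suc x)) (lemma (u (sucℤ x)) (u x)))
        where
        lemma : ∀ p q → q ≡ + 0 * p + q
        lemma = solve-∀
      additive⇒Fan b≤x (node {x} {y} {z} xz l r) = fan
        (trans (Fan.fromˡ fl) (trans (cong (λ v → α l * u x + v) uy) (lemmaˡ (α l) (u x) (u z))))
        (trans (Fan.fromʳ fr) (trans (cong (λ v → β r * u z + v) uy) (lemmaʳ (β r) (u x) (u z))))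
        where
        fl : Fan u l
        fl = additive⇒Fan b≤x l
        fr : Fan u r
        fr = additive⇒Fan (ℤₚ.≤-trans b≤x (ℤₚ.<⇒≤ (tree-< l))) r
        uy : u y ≡ u x + u z
        uy = additive b≤x xz l r fl fr
        lemmaˡ : ∀ c p q → c * p + (p + q) ≡ (+ 1 + c) * p + q
        lemmaˡ = solve-∀
        lemmaʳ : ∀ c p q → c * q + (p + q) ≡ (+ 1 + c) * q + p
        lemmaʳ = solve-∀

    -- The recurrence at the apex y involves its two neighbours, which the fans express through x, y
    -- and z. As A(y) exceeds the total size of the fans by 1, what remains is u(y) = u(x) + u(z).
    solution⇒Fan : ∀ u b → (∀ x → b ℤ.< x → Solves u x) →
      ∀ {x z} → b ℤ.≤ x → (t : Tree x z) → Fan u t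
    solution⇒Fan u b solves = additive⇒Fan u b additive
      where
      open ≡-Reasoning
      lemma₁ : ∀ p q y → y ≡ (+ 1 + (p + q)) * y - (p + q) * y
      lemma₁ = solve-∀
      lemma₂ : ∀ p q x y z → (q * y + z) + (p * y + x) - (p + q) * y ≡ x + z
      lemma₂ = solve-∀
      additive : ∀ {x y z} → b ℤ.≤ x → Arc x z → (l : Tree x y) (r : Tree y z) →
                 Fan u l → Fan u r → u y ≡ u x + u z
      additive {x} {y} {z} b≤x xz l r fl fr = begin
        u y                                                      ≡⟨ lemma₁ (β l) (α r) (u y) ⟩
        (+ 1 + (β l + α r)) * u y - (β l + α r) * u y            ≡⟨ cong (λ v → v * u y - (β l + α r) * u y) (A-middle xz l r) ⟨
        A y * u y - (β l + α r) * u y                            ≡⟨ cong (λ v → v - (β l + α r) * u y) (solves y (ℤₚ.≤-<-trans b≤x (tree-< l))) ⟨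
        u (sucℤ y) + u (pred y) - (β l + α r) * u y              ≡⟨ cong₂ (λ v w → v + w - (β l + α r) * u y) (Fan.fromˡ fr) (Fan.fromʳ fl) ⟩
        (α r * u y + u z) + (β l * u y + u x) - (β l + α r) * u y ≡⟨ lemma₂ (β l) (α r) (u x) (u y) (u z) ⟩
        u x + u z                                                ∎

    module _ (w : ℤ → ℤ) (b : ℤ) (solves : ∀ x → b ℤ.< x → Solves w x) where

      solves-suc : ∀ {x} → b ℤ.≤ x → w (sucℤ (sucℤ x)) + w x ≡ A (sucℤ x) * w (sucℤ x)
      solves-suc {x} b≤x = subst (λ y → w (sucℤ (sucℤ x)) + w y ≡ A (sucℤ x) * w (sucℤ x)) (ℤₚ.pred-suc x)
        (solves (sucℤ x) (ℤₚ.≤-<-trans b≤x (i<suc[i] x)))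

      zero-forward : ∀ {x} → b ℤ.≤ x → w x ≡ + 0 → w (sucℤ x) ≡ + 0 → w (sucℤ (sucℤ x)) ≡ + 0
      zero-forward {x} b≤x wx≡0 wsx≡0 = begin
        w (sucℤ (sucℤ x))             ≡⟨ ℤₚ.+-identityʳ _ ⟨
        w (sucℤ (sucℤ x)) + + 0       ≡⟨ cong (λ v → w (sucℤ (sucℤ x)) + v) wx≡0 ⟨
        w (sucℤ (sucℤ x)) + w x       ≡⟨ solves-suc b≤x ⟩
        A (sucℤ x) * w (sucℤ x)       ≡⟨ cong (A (sucℤ x) *_) wsx≡0 ⟩
        A (sucℤ x) * + 0              ≡⟨ ℤₚ.*-zeroʳ (A (sucℤ x)) ⟩
        + 0                           ∎
        where open ≡-Reasoning

      zero-backward : ∀ {x} → b ℤ.≤ x → w (sucℤ x) ≡ + 0 → w (sucℤ (sucℤ x)) ≡ + 0 → w x ≡ + 0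
      zero-backward {x} b≤x wsx≡0 wssx≡0 = begin
        w x                           ≡⟨ ℤₚ.+-identityˡ _ ⟨
        + 0 + w x                     ≡⟨ cong (λ v → v + w x) wssx≡0 ⟨
        w (sucℤ (sucℤ x)) + w x       ≡⟨ solves-suc b≤x ⟩
        A (sucℤ x) * w (sucℤ x)       ≡⟨ cong (A (sucℤ x) *_) wsx≡0 ⟩
        A (sucℤ x) * + 0              ≡⟨ ℤₚ.*-zeroʳ (A (sucℤ x)) ⟩
        + 0                           ∎
        where open ≡-Reasoning

      zero-at-b : ∀ t → w (b ⊕ t) ≡ + 0 → w (b ⊕ suc t) ≡ + 0 → w b ≡ + 0 × w (sucℤ b) ≡ + 0
      zero-at-b zero    p q = p , q
      zero-at-b (suc t) p q = zero-at-b t (zero-backward (x≤x⊕t b t) p q) p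

      zero-above-b : w b ≡ + 0 → w (sucℤ b) ≡ + 0 → ∀ t → w (b ⊕ t) ≡ + 0 × w (b ⊕ suc t) ≡ + 0
      zero-above-b p q zero    = p , q
      zero-above-b p q (suc t) with zero-above-b p q t
      ... | p′ , q′ = q′ , zero-forward (x≤x⊕t b t) p′ q′

      -- The fan identity adds a zero at x + 1 to those at x and z. Both neighbours have coefficient
      -- 1 in the recurrence, so two adjacent zeros propagate down to b and then up again.
      zero-everywhere : ∀ {x z} → b ℤ.≤ x → Tree x z → w x ≡ + 0 → w z ≡ + 0 → ∀ y → b ℤ.≤ y → w y ≡ + 0
      zero-everywhere {x} {z} b≤x t wx≡0 wz≡0 y b≤y with ≤⇒⊕ b≤x | ≤⇒⊕ b≤y
      ... | d , refl | e , refl with zero-at-b d wx≡0 (begin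
          w (sucℤ x)              ≡⟨ Fan.fromˡ (solution⇒Fan w b solves b≤x t) ⟩
          α t * w x + w z         ≡⟨ cong₂ (λ p q → α t * p + q) wx≡0 wz≡0 ⟩
          α t * + 0 + + 0         ≡⟨ lemma (α t) ⟩
          + 0                     ∎)
        where
        open ≡-Reasoning
        lemma : ∀ c → c * + 0 + + 0 ≡ + 0
        lemma = solve-∀
      ...   | p , q = proj₁ (zero-above-b p q e)

    module _ (s : ℤ) (label : Fin n → ℕ) (labels : AreLabels T s label) where

      L : ℤ → ℤ
      L x = + label (idx x)

      L-Bridge : ∀ {x} → Bridge x → L x ≡ + 1
      L-Bridge b = cong +_ (label-Bridge s label labels b)

      L-Tri : ∀ {x y z} → Tri x y z → L y ≡ L x + L z
      L-Tri t = cong +_ (label-Tri s label labels t)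

      L-Fan : ∀ {x z} (t : Tree x z) → Fan L t
      L-Fan {x} = additive⇒Fan L x (λ _ xz l r _ _ → L-Tri (node-Tri xz l r)) ℤₚ.≤-refl

      L-solves : ∀ y → Solves L y
      L-solves y with Bridge? y
      ... | no ¬by with ¬Bridge⇒Middle ¬by
      ...   | middle {x} {z} xz l r = begin
        L (sucℤ y) + L (pred y)                    ≡⟨ cong₂ _+_ (Fan.fromˡ (L-Fan r)) (Fan.fromʳ (L-Fan l)) ⟩
        (α r * L y + L z) + (β l * L y + L x)      ≡⟨ lemma₁ (β l) (α r) (L x) (L y) (L z) ⟩
        (β l + α r) * L y + (L x + L z)            ≡⟨ cong (λ v → (β l + α r) * L y + v) (L-Tri (node-Tri xz l r)) ⟨
        (β l + α r) * L y + L y                    ≡⟨ lemma₂ (β l + α r) (L y) ⟩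
        (+ 1 + (β l + α r)) * L y                  ≡⟨ cong (_* L y) (A-middle xz l r) ⟨
        A y * L y                                  ∎
        where
        open ≡-Reasoning
        lemma₁ : ∀ p q x y z → (q * y + z) + (p * y + x) ≡ (p + q) * y + (x + z)
        lemma₁ = solve-∀
        lemma₂ : ∀ c y → c * y + y ≡ (+ 1 + c) * y
        lemma₂ = solve-∀
      -- Here L(x) + L(z) = 2 = 2 L(y), which matches the two caps counted in A(y).
      L-solves y | yes by with previous-consecutive by | next-consecutive by
      ... | x , xy | z , yz = begin
        L (sucℤ y) + L (pred y)                    ≡⟨ cong₂ _+_ (Fan.fromˡ (L-Fan r)) (Fan.fromʳ (L-Fan l)) ⟩
        (α r * L y + L z) + (β l * L y + L x)      ≡⟨ cong₂ (λ v w → (α r * L y + v) + (β l * L y + w)) (L-Bridge (Consecutive.by yz)) (L-Bridge (Consecutive.bx xy)) ⟩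
        (α r * L y + + 1) + (β l * L y + + 1)      ≡⟨ cong (λ v → (α r * v + + 1) + (β l * v + + 1)) (L-Bridge by) ⟩
        (α r * + 1 + + 1) + (β l * + 1 + + 1)      ≡⟨ lemma (β l) (α r) ⟩
        (+ 2 + (β l + α r)) * + 1                  ≡⟨ cong₂ _*_ (A-bridge xy yz) (L-Bridge by) ⟨
        A y * L y                                  ∎
        where
        open ≡-Reasoning
        l = consecutive-Tree xy
        r = consecutive-Tree yz
        lemma : ∀ p q → (q * + 1 + + 1) + (p * + 1 + + 1) ≡ (+ 2 + (p + q)) * + 1
        lemma = solve-∀

      -- Growth along the bridging vertices

      module _ (u : ℤ → ℤ) (b : ℤ) (solves : ∀ x → b ℤ.< x → Solves u x)
        (ub≡0 : u b ≡ + 0) (usb≡1 : u (sucℤ b) ≡ + 1) where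

        wronskian : ∀ t → u (b ⊕ suc t) * L (b ⊕ t) - u (b ⊕ t) * L (b ⊕ suc t) ≡ L b
        wronskian zero = begin
          u (sucℤ b) * L b - u b * L (sucℤ b)    ≡⟨ cong₂ (λ p q → p * L b - q * L (sucℤ b)) usb≡1 ub≡0 ⟩
          + 1 * L b - + 0 * L (sucℤ b)           ≡⟨ lemma (L b) (L (sucℤ b)) ⟩
          L b                                    ∎
          where
          open ≡-Reasoning
          lemma : ∀ p q → + 1 * p - + 0 * q ≡ p
          lemma = solve-∀
        wronskian (suc t) = begin
          u₂ * L₁ - u₁ * L₂                              ≡⟨ lemma₁ u₀ u₁ u₂ L₀ L₁ L₂ ⟩
          (u₂ + u₀) * L₁ - u₁ * (L₂ + L₀) + (u₁ * L₀ - u₀ * L₁)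
            ≡⟨ cong₂ (λ p q → p * L₁ - u₁ * q + (u₁ * L₀ - u₀ * L₁))
                 (solves-suc u b solves (x≤x⊕t b t)) (solves-suc L b (λ x _ → L-solves x) (x≤x⊕t b t)) ⟩
          A₁ * u₁ * L₁ - u₁ * (A₁ * L₁) + (u₁ * L₀ - u₀ * L₁)  ≡⟨ lemma₂ A₁ u₀ u₁ L₀ L₁ ⟩
          u₁ * L₀ - u₀ * L₁                              ≡⟨ wronskian t ⟩
          L b                                            ∎
          where
          open ≡-Reasoning
          A₁ = A (b ⊕ suc t)
          u₀ = u (b ⊕ t)
          u₁ = u (b ⊕ suc t)
          u₂ = u (b ⊕ suc (suc t))
          L₀ = L (b ⊕ t)
          L₁ = L (b ⊕ suc t)
          L₂ = L (b ⊕ suc (suc t))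
          lemma₁ : ∀ a b c p q r → c * q - b * r ≡ (c + a) * q - b * (r + p) + (b * p - a * q)
          lemma₁ = solve-∀
          lemma₂ : ∀ k a b p q → k * b * q - b * (k * q) + (b * p - a * q) ≡ b * p - a * q
          lemma₂ = solve-∀

        -- The fan identities turn the Wronskian at x into (α u(x) + u(z)) L(x) - u(x) (α L(x) +
        -- L(z)) with the same α. The α terms cancel, and L(x) = L(z) = 1 leaves u(z) - u(x).
        bridge-step : ∀ {x z} → b ℤ.≤ x → Consecutive x z → u z ≡ u x + L b
        bridge-step {x} {z} b≤x xz with ≤⇒⊕ b≤x
        ... | t , refl = begin
          u z                                                ≡⟨ lemma (α tr) (u x) (u z) ⟩
          u x + ((α tr * u x + u z) * + 1 - u x * (α tr * + 1 + + 1))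
            ≡⟨ cong (λ v → u x + ((α tr * u x + u z) * v - u x * (α tr * v + + 1))) (L-Bridge (Consecutive.bx xz)) ⟨
          u x + ((α tr * u x + u z) * L x - u x * (α tr * L x + + 1))
            ≡⟨ cong (λ v → u x + ((α tr * u x + u z) * L x - u x * (α tr * L x + v))) (L-Bridge (Consecutive.by xz)) ⟨
          u x + ((α tr * u x + u z) * L x - u x * (α tr * L x + L z))
            ≡⟨ cong₂ (λ v w → u x + (v * L x - u x * w)) (Fan.fromˡ (solution⇒Fan u b solves b≤x tr)) (Fan.fromˡ (L-Fan tr)) ⟨
          u x + (u (sucℤ x) * L x - u x * L (sucℤ x))        ≡⟨ cong (λ v → u x + v) (wronskian t) ⟩
          u x + L b                                          ∎
          where
          open ≡-Reasoning
          tr = consecutive-Tree xz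
          lemma : ∀ c p q → q ≡ p + ((c * p + q) * + 1 - p * (c * + 1 + + 1))
          lemma = solve-∀

        -- The first block to the right of that of b. Bridging arcs are counted per superscript, so
        -- the telescoping runs over the positions of one block.
        k : ℤ
        k = sucℤ (sup b)

        X : ℕ → ℤ
        X t = + t + k * + n

        X-suc : ∀ t → X (suc t) ≡ sucℤ (X t)
        X-suc t = ℤₚ.suc-+ t (k * + n)

        b≤X : ∀ t → b ℤ.≤ X t
        b≤X zero    = ℤₚ.≤-trans b≤ (ℤₚ.≤-reflexive (sym (ℤₚ.+-identityˡ (k * + n))))
          where
          b≤ : b ℤ.≤ k * + n
          b≤ = ℤₚ.<⇒≤ (begin-strict
            b                                ≡⟨ pos-vtx b ⟨
            + toℕ (idx b) + sup b * + n      <⟨ ℤₚ.+-monoˡ-< (sup b * + n) (ℤ.+<+ (toℕ<n (idx b))) ⟩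
            + n + sup b * + n                ≡⟨ ℤₚ.suc-* (sup b) (+ n) ⟨
            k * + n                          ∎)
            where open ℤₚ.≤-Reasoning
        b≤X (suc t) = ℤₚ.≤-trans (b≤X t) (ℤₚ.≤-trans (ℤₚ.i≤suc[i] (X t)) (ℤₚ.≤-reflexive (sym (X-suc t))))

        first : ℤ → ℤ
        first x = proj₁ (next-bridge x)

        first-First : ∀ x → First x (first x)
        first-First x = proj₂ (next-bridge x)

        module _ (r : ℕ) (bridges : NumberOfBridgingArcs T r) where

          -- When t increases by 1, `first (X t)` moves to the next bridging vertex if `X t` is
          -- bridging and stays otherwise, so u gains L(b) once for each of the r bridging vertices
          -- of the block.
          telescoped : u (first (X n)) ≡ u (first (X 0)) + + r * L b
          telescoped = subst (λ c → u (first (X n)) ≡ u (first (X 0)) + + c * L b)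
            (filter-cardinality joined-k? (bridges k))
            (telescope joined-k? (L b) n (λ i → i) (λ t → u (first (X t))) up stay)
            where
            joined-k? : Decidable₁ (λ j → Joined T (upper k) (lower j k))
            joined-k? j = joined? T (upper k) (lower j k)
            up : ∀ i → Joined T (upper k) (lower i k) → u (first (X (suc (toℕ i)))) ≡ u (first (X (toℕ i))) + L b
            up i j = begin
              u (first (X (suc (toℕ i))))      ≡⟨ bridge-step (b≤X (toℕ i)) c ⟩
              u (X (toℕ i)) + L b              ≡⟨ cong (λ x → u x + L b) (First-unique (First-self bi) (first-First _)) ⟩
              u (first (X (toℕ i))) + L b      ∎
              where
              open ≡-Reasoning
              bi : Bridge (pos i k)
              bi = joined-Bridge j
              c : Consecutive (X (toℕ i)) (first (X (suc (toℕ i))))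
              c = First-consecutive bi (subst (λ x → First x (first (X (suc (toℕ i))))) (X-suc (toℕ i)) (first-First _))
            stay : ∀ i → ¬ Joined T (upper k) (lower i k) → u (first (X (suc (toℕ i)))) ≡ u (first (X (toℕ i)))
            stay i ¬j = cong u (First-unique
              (First-pred (λ b → ¬j (Bridge-joined b))
                (subst (λ x → First x (first (X (suc (toℕ i))))) (X-suc (toℕ i)) (first-First _)))
              (first-First _))

          p : ℤ
          p = first (X 0)

          b≤p : b ℤ.≤ p
          b≤p = ℤₚ.≤-trans (b≤X 0) (proj₁ (first-First (X 0)))

          -- `X n` is `X 0` shifted by one period, so the first bridging vertex from there on is p +
          -- n.
          u[p+n] : u (p + + n) ≡ u p + + r * L b
          u[p+n] = trans (cong u (First-unique
            (subst (λ x → First x (p + + n)) (lemma (k * + n) (+ n)) (First-+n (first-First (X 0))))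
            (first-First (X n)))) telescoped
            where
            lemma : ∀ c n → + 0 + c + n ≡ n + c
            lemma = solve-∀

          w : ℤ → ℤ
          w x = u (x + + n) - u x - + r * L b * L x

          A-+n : ∀ x → A (x + + n) ≡ A x
          A-+n x = cong (λ i → + a i) (lower-injective (vtx-+n x))
            where
            lower-injective : ∀ {i j : Fin n} {k l : ℤ} → _≡_ {A = Vertex n} (lower i k) (lower j l) → i ≡ j
            lower-injective refl = refl

          w-solves : ∀ x → b ℤ.< x → Solves w x
          w-solves x b<x = begin
            w (sucℤ x) + w (pred x)
              ≡⟨ cong₂ (λ y z → (u y - u (sucℤ x) - c * L (sucℤ x)) + (u z - u (pred x) - c * L (pred x)))
                   (ℤₚ.+-assoc (+ 1) x (+ n)) (ℤₚ.pred-+ x (+ n)) ⟩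
            (u (sucℤ x′) - u (sucℤ x) - c * L (sucℤ x)) + (u (pred x′) - u (pred x) - c * L (pred x))
              ≡⟨ lemma₁ c (u (sucℤ x′)) (u (sucℤ x)) (L (sucℤ x)) (u (pred x′)) (u (pred x)) (L (pred x)) ⟩
            (u (sucℤ x′) + u (pred x′)) - (u (sucℤ x) + u (pred x)) - c * (L (sucℤ x) + L (pred x))
              ≡⟨ cong₂ (λ v v′ → v - v′ - c * (L (sucℤ x) + L (pred x)))
                   (trans (solves x′ b<x′) (cong (_* u x′) (A-+n x))) (solves x b<x) ⟩
            A x * u x′ - A x * u x - c * (L (sucℤ x) + L (pred x))
              ≡⟨ cong (λ v → A x * u x′ - A x * u x - c * v) (L-solves x) ⟩
            A x * u x′ - A x * u x - c * (A x * L x)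
              ≡⟨ lemma₂ c (A x) (u x′) (u x) (L x) ⟩
            A x * w x ∎
            where
            open ≡-Reasoning
            c = + r * L b
            x′ = x + + n
            b<x′ : b ℤ.< x′
            b<x′ = ℤₚ.<-≤-trans b<x (ℤₚ.i≤i+j x (+ n))
            lemma₁ : ∀ c p q r s t v → (p - q - c * r) + (s - t - c * v) ≡ (p + s) - (q + t) - c * (r + v)
            lemma₁ = solve-∀
            lemma₂ : ∀ c k p q l → k * p - k * q - c * (k * l) ≡ k * (p - q - c * l)
            lemma₂ = solve-∀

          w-zero : ∀ {x} → Bridge x → u (x + + n) ≡ u x + + r * L b → w x ≡ + 0
          w-zero {x} bx eq = trans (cong₂ (λ v l → v - u x - + r * L b * l) eq (L-Bridge bx)) (lemma (u x) (+ r * L b))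
            where
            lemma : ∀ p q → p + q - p - q * + 1 ≡ + 0
            lemma = solve-∀

          -- It suffices that `w` vanishes at p and at the next bridging vertex q, since these are
          -- the ends of an edge.
          difference : ∀ x → b ℤ.≤ x → u (x + + n) - u x ≡ + r * L b * L x
          difference x b≤x with next-consecutive (proj₁ (proj₂ (first-First (X 0))))
          ... | q , pq = trans (lemma (u (x + + n) - u x) (+ r * L b * L x))
            (trans (cong (λ v → v + + r * L b * L x)
              (zero-everywhere w b w-solves b≤p (consecutive-Tree pq)
                (w-zero (Consecutive.bx pq) u[p+n]) (w-zero (Consecutive.by pq) u[q+n]) x b≤x))
              (ℤₚ.+-identityˡ _))
            where
            open ≡-Reasoning
            lemma : ∀ p q → p ≡ p - q + q
            lemma = solve-∀
            lemma′ : ∀ p q r → p + q + r ≡ p + r + q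
            lemma′ = solve-∀
            u[q+n] : u (q + + n) ≡ u q + + r * L b
            -- From p to q and from p + n to q + n, u increases by the same L(b).
            u[q+n] = begin
              u (q + + n)               ≡⟨ bridge-step (ℤₚ.≤-trans b≤p (ℤₚ.i≤i+j p (+ n))) (Consecutive-+n pq) ⟩
              u (p + + n) + L b         ≡⟨ cong (λ v → v + L b) u[p+n] ⟩
              u p + + r * L b + L b     ≡⟨ lemma′ (u p) (+ r * L b) (L b) ⟩
              u p + L b + + r * L b     ≡⟨ cong (λ v → v + + r * L b) (bridge-step b≤p pq) ⟨
              u q + + r * L b           ∎

+n-periodic⇒*n-periodic : ∀ {A : Set} (c : ℤ) (g : ℤ → A) → (∀ x → g (x + c) ≡ g x) →
  ∀ k x → g (x + k * c) ≡ g x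
+n-periodic⇒*n-periodic c g period (+ k) = forward k
  where
  lemma : ∀ x k c → x + (+ 1 + k) * c ≡ x + k * c + c
  lemma = solve-∀
  forward : ∀ k x → g (x + + k * c) ≡ g x
  forward zero    x = cong g (ℤₚ.+-identityʳ x)
  forward (suc k) x = trans (cong g (lemma x (+ k) c)) (trans (period _) (forward k x))
+n-periodic⇒*n-periodic c g period ℤ.-[1+ k ] x =
  trans (sym (+n-periodic⇒*n-periodic c g period (+ suc k) _)) (cong g (lemma x (+ suc k) c))
  where
  lemma : ∀ x k c → x + ℤ.- k * c + k * c ≡ x
  lemma = solve-∀

-- Friezes

module _ {m : ℤ → ℤ → ℤ} (frieze : IsInfiniteFrieze m) where
  open IsInfiniteFrieze frieze

  frieze-0 : ∀ i → m i (pred (pred i)) ≡ + 0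
  frieze-0 i = trans (cong (m i) (lemma i)) (zeros i)
    where
    lemma : ∀ i → ℤ.- + 1 + (ℤ.- + 1 + i) ≡ i - + 2
    lemma = solve-∀

  frieze-1 : ∀ i → m i (pred i) ≡ + 1
  frieze-1 i = trans (cong (m i) (ℤₚ.+-comm (ℤ.- + 1) i)) (ones i)

  frieze-diamond : ∀ i j → pred i ℤ.≤ j →
    m i j * m (sucℤ i) (sucℤ j) - m (sucℤ i) j * m i (sucℤ j) ≡ + 1
  frieze-diamond i j i-1≤j =
    subst₂ (λ i′ j′ → m i j * m i′ j′ - m i′ j * m i j′ ≡ + 1) (ℤₚ.+-comm i (+ 1)) (ℤₚ.+-comm j (+ 1))
      (diamond i j (subst (ℤ._≤ j) (ℤₚ.+-comm (ℤ.- + 1) i) i-1≤j))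

  frieze-≢0 : ∀ {i j} → pred i ℤ.≤ j → ℤ.NonZero (m i j)
  frieze-≢0 {i} {j} i-1≤j with ≤⇒<⊎≡ i-1≤j
  ... | inj₂ refl  = subst ℤ.NonZero (sym (frieze-1 i)) _
  ... | inj₁ i-1<j = ℤ.>-nonZero (positive i j (subst (ℤ._≤ j) (ℤₚ.suc-pred i) (ℤₚ.i<j⇒suc[i]≤j i-1<j)))

  -- Induction on the distance from the diagonal of ones, passing from row i + 1 to row i. The
  -- diamonds at two adjacent columns both equal 1, so the ratio (m(i,x+1) + m(i,x-1)) / m(i,x) is
  -- the same in both rows; cancelling the nonzero m(i+1,x) keeps the argument in the integers.
  frieze-recurrence : ∀ i j → pred i ℤ.≤ j → m i (sucℤ j) + m i (pred j) ≡ m (sucℤ j) (sucℤ j) * m i j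
  frieze-recurrence i j i-1≤j with ≤⇒⊕ i-1≤j
  ... | d , refl = go d i
    where
    open ≡-Reasoning
    lemma₁ : ∀ a t v w s q → t * (v + w) ≡ a * (s + q) - (a * s - t * v) + (w * t - q * a)
    lemma₁ = solve-∀
    lemma₂ : ∀ a k t → a * (k * t) - + 1 + + 1 ≡ t * (k * a)
    lemma₂ = solve-∀
    lemma₃ : ∀ p → p + + 0 ≡ p * + 1
    lemma₃ = solve-∀
    pred[suc]⊕ : ∀ i d → pred (sucℤ i) ⊕ d ≡ pred i ⊕ suc d
    pred[suc]⊕ i zero    = trans (ℤₚ.pred-suc i) (sym (ℤₚ.suc-pred i))
    pred[suc]⊕ i (suc d) = cong sucℤ (pred[suc]⊕ i d)
    go : ∀ d i → let j = pred i ⊕ d in m i (sucℤ j) + m i (pred j) ≡ m (sucℤ j) (sucℤ j) * m i j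
    go zero i = begin
      m i (sucℤ (pred i)) + m i (pred (pred i))   ≡⟨ cong₂ (λ j v → m i j + v) (ℤₚ.suc-pred i) (frieze-0 i) ⟩
      m i i + + 0                                 ≡⟨ lemma₃ (m i i) ⟩
      m i i * + 1                                 ≡⟨ cong₂ (λ j v → m j j * v) (ℤₚ.suc-pred i) (frieze-1 i) ⟨
      m (sucℤ (pred i)) (sucℤ (pred i)) * m i (pred i) ∎
    go (suc d) i = ℤₚ.*-cancelˡ-≡ t _ _ {{frieze-≢0 i≤x}} (begin
      t * (m i (sucℤ x) + m i (pred x))
        ≡⟨ lemma₁ (m i x) t (m i (sucℤ x)) (m i (pred x)) (m (sucℤ i) (sucℤ x)) (m (sucℤ i) (pred x)) ⟩
      m i x * (m (sucℤ i) (sucℤ x) + m (sucℤ i) (pred x))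
        - (m i x * m (sucℤ i) (sucℤ x) - t * m i (sucℤ x))
        + (m i (pred x) * t - m (sucℤ i) (pred x) * m i x)
        ≡⟨ cong₂ (λ v w → m i x * (m (sucℤ i) (sucℤ x) + m (sucℤ i) (pred x)) - v + w)
             (frieze-diamond i x i-1≤x)
             (subst (λ y → m i (pred x) * m (sucℤ i) y - m (sucℤ i) (pred x) * m i y ≡ + 1) (ℤₚ.suc-pred x)
               (frieze-diamond i (pred x) (subst (pred i ℤ.≤_) (sym (ℤₚ.pred-suc (pred i ⊕ d))) (x≤x⊕t (pred i) d)))) ⟩
      m i x * (m (sucℤ i) (sucℤ x) + m (sucℤ i) (pred x)) - + 1 + + 1
        ≡⟨ cong (λ v → m i x * v - + 1 + + 1) ih ⟩
      m i x * (m (sucℤ x) (sucℤ x) * t) - + 1 + + 1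
        ≡⟨ lemma₂ (m i x) (m (sucℤ x) (sucℤ x)) t ⟩
      t * (m (sucℤ x) (sucℤ x) * m i x) ∎)
      where
      x : ℤ
      x = pred i ⊕ suc d
      t : ℤ
      t = m (sucℤ i) x
      i-1≤x : pred i ℤ.≤ x
      i-1≤x = x≤x⊕t (pred i) (suc d)
      i≤x : pred (sucℤ i) ℤ.≤ x
      i≤x = subst (pred (sucℤ i) ℤ.≤_) (pred[suc]⊕ i d) (x≤x⊕t (pred (sucℤ i)) d)
      ih : m (sucℤ i) (sucℤ x) + m (sucℤ i) (pred x) ≡ m (sucℤ x) (sucℤ x) * t
      ih = subst (λ y → m (sucℤ i) (sucℤ y) + m (sucℤ i) (pred y) ≡ m (sucℤ y) (sucℤ y) * m (sucℤ i) y)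
             (pred[suc]⊕ i d) (go d (sucℤ i))

proposition5p4 : (n : ℕ) .{{_ : NonZero n}}
    (T : ArcCollection n) → IsTriangulation T → IsPeriodic T →
    (r : ℕ) → 1 ≤ r → r ≤ n → NumberOfBridgingArcs T r →
    (m : ℤ → ℤ → ℤ) → IsAssociatedFrieze T m →
    (s : ℤ) (label : Fin n → ℕ) → AreLabels T s label →
    (i : ℤ) (k : ℕ) → 1 ≤ k → k ≤ n →
    commonDifference n m i k
    ≡ + r * + label (reduce n (i - + 1)) * + label (reduce n (i + + k - + 2))
proposition5p4 n T triangulation periodic r _ _ bridges m associated s label labels i k 1≤k _
  with IsAssociatedFrieze.quiddity associated
... | a , quiddity , m≡a = trans
  (difference a quiddity s label labels (m i) b solves (frieze-0 frieze i)
    (trans (cong (m i) (ℤₚ.suc-pred (pred i))) (frieze-1 frieze i)) r bridges j b≤j)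
  (cong₂ (λ v w → + r * + label v * + label w)
    (sym (trans (reduce≡idx (i - + 1)) (cong idx (lemma₁ i))))
    (sym (trans (reduce≡idx (i + + k - + 2)) (cong idx (lemma₂ i (+ k))))))
  where
  open IsAssociatedFrieze associated using (frieze) renaming (periodic to m-periodic)
  open Strip n
  open Triangulated n T triangulation periodic using (A; Solves; difference)

  -- Column x of the frieze is paired with `vtx x`, which the frieze numbers x + 1. Hence b = i - 2,
  -- where row i has its 0, carries the label with index i - 1, and j = i + k - 3 the one with index
  -- i + k - 2.
  b j : ℤ
  b = pred (pred i)
  j = i + + k - + 3

  lemma₁ : ∀ i → i - + 1 - + 1 ≡ ℤ.- + 1 + (ℤ.- + 1 + i)
  lemma₁ = solve-∀

  lemma₂ : ∀ i k → i + k - + 2 - + 1 ≡ i + k - + 3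
  lemma₂ = solve-∀

  lemma₃ : ∀ i → i + + 1 - + 3 ≡ ℤ.- + 1 + (ℤ.- + 1 + i)
  lemma₃ = solve-∀

  b≤j : b ℤ.≤ j
  b≤j = subst (ℤ._≤ j) (lemma₃ i) (ℤₚ.+-monoˡ-≤ (ℤ.- + 3) (ℤₚ.+-monoʳ-≤ i (ℤ.+≤+ 1≤k)))

  -- The quiddity fixes the diagonal at 1, ..., n only; periodicity reduces x to `+ toℕ (idx x)`.
  diagonal : ∀ x → m (sucℤ x) (sucℤ x) ≡ A a quiddity x
  diagonal x = trans (cong (λ y → m (sucℤ y) (sucℤ y)) (sym (pos-vtx x)))
    (trans (+n-periodic⇒*n-periodic (+ n) (λ y → m (sucℤ y) (sucℤ y)) step (sup x) (+ toℕ (idx x)))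
      (m≡a (idx x)))
    where
    step : ∀ y → m (sucℤ (y + + n)) (sucℤ (y + + n)) ≡ m (sucℤ y) (sucℤ y)
    step y = trans (cong (λ z → m z z) (sym (ℤₚ.+-assoc (+ 1) y (+ n)))) (sym (m-periodic (sucℤ y) (sucℤ y) ℤₚ.≤-refl))

  solves : ∀ x → b ℤ.< x → Solves a quiddity (m i) x
  solves x b<x = trans
    (frieze-recurrence frieze i x (subst (ℤ._≤ x) (ℤₚ.suc-pred (pred i)) (ℤₚ.i<j⇒suc[i]≤j b<x)))
    (cong (λ v → v * m i x) (diagonal x))
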